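{- Let $(a_n)_{n\ge0}$ be the sequence, listed in increasing order, of the non-negative integers $m$ such that $240m+121$ is a perfect square. Then $$\sum_{n=0}^\infty(-1)^{\lfloor (n+2)/4\rfloor}q^{a_n}=\frac{(q^3,q^5,q^8;q^8)_\infty\,(q^2,q^{14};q^{16})_\infty}{(q,q^4;q^5)_\infty}.$$
   Context: Here $q$ is a complex number with $|q|<1$ (equivalently, the identity may be read as an identity of formal power series in $q$). For a complex number $a$, $(a;q)_\infty:=\prod_{i=0}^\infty(1-aq^i)$, and $(a_1,a_2,\dots,a_m;q)_\infty:=\prod_{j=1}^m(a_j;q)_\infty$. $\lfloor x\rfloor$ is the floor function. -}

module Defs where

open import Data.Nat as ℕ using (ℕ; zero; suc; _<_; _≡ᵇ_)
open import Data.Nat.DivMod using (_/_)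
open import Data.Integer as ℤ using (ℤ; +_; -_; _*_; _+_; _-_; 1ℤ; 0ℤ; -1ℤ; _^_)
open import Data.Bool using (if_then_else_)
open import Data.List using (List; []; _∷_)
open import Data.Product using (∃)
open import Relation.Binary.PropositionalEquality using (_≡_)

-- Formal power series in q with integer coefficients: n ↦ coefficient of q^n.
FPS : Set
FPS = ℕ → ℤ

sumTo : ℕ → (ℕ → ℤ) → ℤ
sumTo zero    f = f 0
sumTo (suc n) f = sumTo n f + f (suc n)

_⊛_ : FPS → FPS → FPS
(f ⊛ g) n = sumTo n (λ k → f k * g (n ℕ.∸ k))

oneS : FPS
oneS n = if n ≡ᵇ 0 then 1ℤ else 0ℤ

oneMinusQ : ℕ → FPS
oneMinusQ e n = (if n ≡ᵇ 0 then 1ℤ else 0ℤ) - (if n ≡ᵇ e then 1ℤ else 0ℤ)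

finPoch : ℕ → ℕ → ℕ → FPS
finPoch r k zero    = oneS
finPoch r k (suc j) = finPoch r k j ⊛ oneMinusQ (r ℕ.+ k ℕ.* j)

-- (q^r ; q^k)_∞ = ∏_{i ≥ 0} (1 - q^{r + k i}) as a formal power series (r ≥ 1):
-- the factors with i ≥ N+1 have exponent > N, so the coefficient of q^N is
-- that of the finite product over i ≤ N.
poch : ℕ → ℕ → FPS
poch r k N = finPoch r k (suc N) N

-- Formal reciprocal of a power series f with f 0 = 1:
-- g 0 = 1, g (n+1) = - Σ_{j=0}^{n} f (j+1) * g (n - j).
private
  dot : FPS → ℕ → List ℤ → ℤ
  dot f j []       = 0ℤ
  dot f j (x ∷ xs) = f (suc j) * x + dot f (suc j) xs

  -- gs f n = [g n , g (n-1) , … , g 0]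
  gs : FPS → ℕ → List ℤ
  gs f zero    = 1ℤ ∷ []
  gs f (suc n) = (- dot f 0 (gs f n)) ∷ gs f n

  hd : List ℤ → ℤ
  hd []      = 0ℤ
  hd (x ∷ _) = x

recip : FPS → FPS
recip f n = hd (gs f n)

IsSquare : ℕ → Set
IsSquare m = ∃ λ k → k ℕ.* k ≡ m

StrictlyIncreasing : (ℕ → ℕ) → Set
StrictlyIncreasing a = ∀ n → a n < a (suc n)

sgn : ℕ → ℤ
sgn n = -1ℤ ^ ((n ℕ.+ 2) / 4)

-- Σ_{n≥0} sgn n q^{a n} for a strictly increasing sequence a (so a n ≥ n and
-- only n ≤ N can contribute to the coefficient of q^N).
lhsSeries : (ℕ → ℕ) → FPS
lhsSeries a N = sumTo N (λ n → if a n ≡ᵇ N then sgn n else 0ℤ)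

rhsSeries : FPS
rhsSeries = (((poch 3 8 ⊛ poch 5 8) ⊛ poch 8 8) ⊛ (poch 2 16 ⊛ poch 14 16))
            ⊛ recip (poch 1 5 ⊛ poch 4 5)

{-# OPTIONS --safe #-}
-- Write D for the left-hand side.  The k > 0 with k² ≡ 121 (mod 240) are, up to
-- sign, the members of four progressions modulo 120, so D is a signed sum of four
-- theta series Σ_{i∈ℤ} q^{60i²+κi+c} with κ = 11, 19, 59, 91.  By the quintuple
-- product identity the numerator C = (q³,q⁵,q⁸;q⁸)(q²,q¹⁴;q¹⁶) and the auxiliary
-- product E = (-q,-q⁹,q¹⁰;q¹⁰)(q⁸,q¹²;q²⁰) are theta series as well, and
-- E·(q,q⁴;q⁵) = (q²;q²).  So the claim reduces to D·(q²;q²) = C·E, an identity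
-- between binary theta series: the left side runs over k + 2n√-5, the right side
-- over 4j + K√-5, and multiplication by (2+√-5)/3, which has norm 1, carries the
-- relevant sublattice of the first onto that of the second.  The lattice points
-- divisible by 3, which occur in neither product, cancel on each side.
module Submission where

open import Defs
open import Algebra.Bundles using (CommutativeRing)
import Algebra.Solver.Ring.NaturalCoefficients.Default as SemiringSolver
open import Data.Bool using (if_then_else_; true; false)
open import Data.Integer as ℤ using (ℤ; +_; -[1+_]; 0ℤ; 1ℤ; -1ℤ; ∣_∣; +≤+)
import Data.Integer.DivMod as ℤDivMod
import Data.Integer.Properties as ℤₚ
open import Data.Integer.Tactic.RingSolver using (solve-∀)
open import Data.List using (List; []; _∷_; _++_; map; upTo; applyUpTo; cartesianProduct; deduplicate)
open import Data.List.Membership.Propositional using (_∈_; _∉_)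
open import Data.List.Membership.Propositional.Properties
  using (∈-map⁺; ∈-map⁻; ∈-++⁺ˡ; ∈-++⁺ʳ; ∈-cartesianProduct⁺; ∈-deduplicate⁺; ∈-upTo⁺)
import Data.List.Membership.DecPropositional as DecMembership
open import Data.List.Relation.Unary.All as All using (All; []; _∷_)
open import Data.List.Relation.Unary.AllPairs using ([]; _∷_)
open import Data.List.Relation.Unary.Any using (here; there)
open import Data.List.Relation.Unary.Unique.Propositional using (Unique)
import Data.List.Relation.Unary.Unique.DecPropositional.Properties as DecUnique
import Data.List.Relation.Unary.Unique.Propositional.Properties as Unique
open import Data.Nat as ℕ using (ℕ; zero; suc; z≤n; s≤s; _≡ᵇ_)
import Data.Nat.DivMod as ℕDivMod
open import Data.Nat.Divisibility using (_∣_; _∣?_; divides)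
import Data.Nat.Properties as ℕₚ
import Data.Nat.Tactic.RingSolver as ℕSolver
open import Data.Product using (_,_; _×_; ∃; proj₁; proj₂; swap)
open import Data.Product.Properties using (≡-dec)
open import Data.Sign as Sign using (Sign; opposite)
import Data.Sign.Properties as Signₚ
open import Data.Sum as Sum using (_⊎_; inj₁; inj₂; [_,_])
open import Function using (_∘_)
open import Level using (0ℓ)
open import Relation.Binary.Definitions using (DecidableEquality)
open import Relation.Binary.PropositionalEquality as ≡ using (_≡_; _≢_)
open import Relation.Nullary using (¬_; Dec; yes; no; does; contradiction)
open import Relation.Nullary.Decidable using (True; toWitness; from-yes; from-no; map′; _×-dec_; _→-dec_)

-- After completing squares, 240 times the exponents of D, (q²;q²), C and E are k² - 121, 20(n² -
-- 1), 5(K² - 25) and 16(j² - 1). As 121 + 20 = 125 + 16 = 141, both products carry the same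
-- constant, so a norm-preserving linear map can match them with no spare power of q. The common
-- lattice is parametrised by (t, b). Neither product structure is visible there until one
-- coordinate is fixed modulo 3: a substitution (3i + ρ, ci + l + d) then removes the cross term,
-- and the double sum falls apart into a product of two theta series. Fixing t modulo 3 shows
-- D·(q²;q²), fixing b modulo 3 shows C·E. The quintuple product identity is proved by the same
-- device. The obstacle is the rearrangement of infinite double sums. All identities are therefore
-- taken modulo q^(N+1), where every family in question vanishes off a finite list. Reindexing,
-- splitting and multiplying become finite statements, and two ways of summing one family must
-- agree.

module PowerSeries where

  open import Data.Integer using (-_; _+_; _*_)
  open import Data.Nat using (_≤_; _<_; _∸_)
  open import Relation.Binary.PropositionalEquality using (refl; sym; trans; cong; cong₂)
  open ≡.≡-Reasoning

  -- Ring laws and reciprocals of formal power series.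

  sumTo-cong : ∀ n {f g : FPS} → (∀ k → k ≤ n → f k ≡ g k) → sumTo n f ≡ sumTo n g
  sumTo-cong zero    f≡g = f≡g 0 z≤n
  sumTo-cong (suc n) f≡g =
    cong₂ _+_ (sumTo-cong n (λ k k≤n → f≡g k (ℕₚ.m≤n⇒m≤1+n k≤n))) (f≡g (suc n) ℕₚ.≤-refl)

  sumTo-suc : ∀ n f → sumTo (suc n) f ≡ f 0 + sumTo n (f ∘ suc)
  sumTo-suc zero    f = refl
  sumTo-suc (suc n) f =
    trans (cong (_+ f (suc (suc n))) (sumTo-suc n f)) (ℤₚ.+-assoc (f 0) _ _)

  zeroS : FPS
  zeroS _ = 0ℤ

  infixl 6 _⊞_
  infix  8 ⊟_

  _⊞_ : FPS → FPS → FPS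
  (f ⊞ g) n = f n + g n

  ⊟_ : FPS → FPS
  (⊟ f) n = - f n

  scale : ℤ → FPS → FPS
  scale c f n = c * f n

  -- With f = f 0 + q f′ the product is f 0 · g + q (f′ g). The ring laws below follow from this
  -- recursion by induction on the coefficient index, for all series at once because f is replaced
  -- by f′ on the way.
  ⊛-suc : ∀ f g n → (f ⊛ g) (suc n) ≡ f 0 * g (suc n) + ((f ∘ suc) ⊛ g) n
  ⊛-suc f g n = sumTo-suc n (λ k → f k * g (suc n ∸ k))

  ⊛-sucʳ : ∀ f g n → (f ⊛ g) (suc n) ≡ (f ⊛ (g ∘ suc)) n + f (suc n) * g 0
  ⊛-sucʳ f g n = cong₂ _+_
    (sumTo-cong n (λ k k≤n → cong (λ m → f k * g m) (ℕₚ.+-∸-assoc 1 k≤n)))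
    (cong (λ m → f (suc n) * g m) (ℕₚ.n∸n≡0 n))

  ⊛-cong : ∀ n {f f′ g g′} → (∀ k → k ≤ n → f k ≡ f′ k) → (∀ k → k ≤ n → g k ≡ g′ k) →
           (f ⊛ g) n ≡ (f′ ⊛ g′) n
  ⊛-cong n f≡ g≡ = sumTo-cong n (λ k k≤n → cong₂ _*_ (f≡ k k≤n) (g≡ (n ∸ k) (ℕₚ.m∸n≤m n k)))

  ⊛-comm : ∀ f g n → (f ⊛ g) n ≡ (g ⊛ f) n
  ⊛-comm f g zero    = ℤₚ.*-comm (f 0) (g 0)
  ⊛-comm f g (suc n) = begin
    (f ⊛ g) (suc n)                           ≡⟨ ⊛-suc f g n ⟩
    f 0 * g (suc n) + ((f ∘ suc) ⊛ g) n       ≡⟨ ℤₚ.+-comm (f 0 * g (suc n)) _ ⟩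
    ((f ∘ suc) ⊛ g) n + f 0 * g (suc n)       ≡⟨ cong₂ _+_ (⊛-comm (f ∘ suc) g n) (ℤₚ.*-comm (f 0) _) ⟩
    (g ⊛ (f ∘ suc)) n + g (suc n) * f 0       ≡⟨ ⊛-sucʳ g f n ⟨
    (g ⊛ f) (suc n)                           ∎

  ⊛-zeroˡ : ∀ f n → (zeroS ⊛ f) n ≡ 0ℤ
  ⊛-zeroˡ f zero    = refl
  ⊛-zeroˡ f (suc n) = trans (⊛-suc zeroS f n) (trans (ℤₚ.+-identityˡ _) (⊛-zeroˡ f n))

  ⊛-identityˡ : ∀ f n → (oneS ⊛ f) n ≡ f n
  ⊛-identityˡ f zero    = ℤₚ.*-identityˡ (f 0)
  ⊛-identityˡ f (suc n) = begin
    (oneS ⊛ f) (suc n)                   ≡⟨ ⊛-suc oneS f n ⟩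
    1ℤ * f (suc n) + (zeroS ⊛ f) n       ≡⟨ cong₂ _+_ (ℤₚ.*-identityˡ (f (suc n))) (⊛-zeroˡ f n) ⟩
    f (suc n) + 0ℤ                       ≡⟨ ℤₚ.+-identityʳ _ ⟩
    f (suc n)                            ∎

  ⊛-distribʳ : ∀ h f g n → ((f ⊞ g) ⊛ h) n ≡ ((f ⊛ h) ⊞ (g ⊛ h)) n
  ⊛-distribʳ h f g zero    = ℤₚ.*-distribʳ-+ (h 0) (f 0) (g 0)
  ⊛-distribʳ h f g (suc n) = begin
    ((f ⊞ g) ⊛ h) (suc n)
      ≡⟨ ⊛-suc (f ⊞ g) h n ⟩
    (f 0 + g 0) * h (suc n) + (((f ∘ suc) ⊞ (g ∘ suc)) ⊛ h) n
      ≡⟨ cong (_+_ ((f 0 + g 0) * h (suc n))) (⊛-distribʳ h (f ∘ suc) (g ∘ suc) n) ⟩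
    (f 0 + g 0) * h (suc n) + (((f ∘ suc) ⊛ h) n + ((g ∘ suc) ⊛ h) n)
      ≡⟨ interchange (f 0) (g 0) (h (suc n)) _ _ ⟩
    (f 0 * h (suc n) + ((f ∘ suc) ⊛ h) n) + (g 0 * h (suc n) + ((g ∘ suc) ⊛ h) n)
      ≡⟨ cong₂ _+_ (⊛-suc f h n) (⊛-suc g h n) ⟨
    ((f ⊛ h) ⊞ (g ⊛ h)) (suc n) ∎
    where
    interchange : ∀ a b c x y → (a + b) * c + (x + y) ≡ (a * c + x) + (b * c + y)
    interchange = solve-∀

  ⊛-scaleˡ : ∀ c f g n → (scale c f ⊛ g) n ≡ c * (f ⊛ g) n
  ⊛-scaleˡ c f g zero    = ℤₚ.*-assoc c (f 0) (g 0)
  ⊛-scaleˡ c f g (suc n) = begin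
    (scale c f ⊛ g) (suc n)
      ≡⟨ ⊛-suc (scale c f) g n ⟩
    c * f 0 * g (suc n) + (scale c (f ∘ suc) ⊛ g) n
      ≡⟨ cong₂ _+_ (ℤₚ.*-assoc c (f 0) (g (suc n))) (⊛-scaleˡ c (f ∘ suc) g n) ⟩
    c * (f 0 * g (suc n)) + c * ((f ∘ suc) ⊛ g) n
      ≡⟨ ℤₚ.*-distribˡ-+ c _ _ ⟨
    c * (f 0 * g (suc n) + ((f ∘ suc) ⊛ g) n)
      ≡⟨ cong (c *_) (⊛-suc f g n) ⟨
    c * (f ⊛ g) (suc n) ∎

  ⊛-assoc : ∀ f g h n → ((f ⊛ g) ⊛ h) n ≡ (f ⊛ (g ⊛ h)) n
  ⊛-assoc f g h zero    = ℤₚ.*-assoc (f 0) (g 0) (h 0)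
  ⊛-assoc f g h (suc n) = begin
    ((f ⊛ g) ⊛ h) (suc n)
      ≡⟨ ⊛-suc (f ⊛ g) h n ⟩
    f 0 * g 0 * h (suc n) + (((f ⊛ g) ∘ suc) ⊛ h) n
      ≡⟨ cong (_+_ (f 0 * g 0 * h (suc n))) (⊛-cong n {g = h} (λ k _ → ⊛-suc f g k) (λ _ _ → refl)) ⟩
    f 0 * g 0 * h (suc n) + ((scale (f 0) (g ∘ suc) ⊞ ((f ∘ suc) ⊛ g)) ⊛ h) n
      ≡⟨ cong (_+_ (f 0 * g 0 * h (suc n))) (⊛-distribʳ h (scale (f 0) (g ∘ suc)) ((f ∘ suc) ⊛ g) n) ⟩
    f 0 * g 0 * h (suc n) + ((scale (f 0) (g ∘ suc) ⊛ h) n + (((f ∘ suc) ⊛ g) ⊛ h) n)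
      ≡⟨ cong (_+_ (f 0 * g 0 * h (suc n)))
           (cong₂ _+_ (⊛-scaleˡ (f 0) (g ∘ suc) h n) (⊛-assoc (f ∘ suc) g h n)) ⟩
    f 0 * g 0 * h (suc n) + (f 0 * ((g ∘ suc) ⊛ h) n + ((f ∘ suc) ⊛ (g ⊛ h)) n)
      ≡⟨ regroup (f 0) (g 0) (h (suc n)) _ _ ⟩
    f 0 * (g 0 * h (suc n) + ((g ∘ suc) ⊛ h) n) + ((f ∘ suc) ⊛ (g ⊛ h)) n
      ≡⟨ cong (λ x → f 0 * x + ((f ∘ suc) ⊛ (g ⊛ h)) n) (⊛-suc g h n) ⟨
    f 0 * (g ⊛ h) (suc n) + ((f ∘ suc) ⊛ (g ⊛ h)) n
      ≡⟨ ⊛-suc f (g ⊛ h) n ⟨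
    (f ⊛ (g ⊛ h)) (suc n) ∎
    where
    regroup : ∀ a b c x y → a * b * c + (a * x + y) ≡ a * (b * c + x) + y
    regroup = solve-∀

  qpow : ℕ → FPS
  qpow e n = if n ≡ᵇ e then 1ℤ else 0ℤ

  qpow-suc-⊛ : ∀ e f n → (qpow (suc e) ⊛ f) (suc n) ≡ (qpow e ⊛ f) n
  qpow-suc-⊛ e f n = trans (⊛-suc (qpow (suc e)) f n) (ℤₚ.+-identityˡ _)

  qpow-+ : ∀ d e n → qpow (d ℕ.+ e) n ≡ (qpow d ⊛ qpow e) n
  qpow-+ zero    e n       = sym (⊛-identityˡ (qpow e) n)
  qpow-+ (suc d) e zero    = refl
  qpow-+ (suc d) e (suc n) = trans (qpow-+ d e n) (sym (qpow-suc-⊛ d (qpow e) n))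

  qpow-vanish : ∀ {n e} → n < e → qpow e n ≡ 0ℤ
  qpow-vanish {zero}  (s≤s _)   = refl
  qpow-vanish {suc n} (s≤s n<e) = qpow-vanish n<e

  -- The private accumulator of `recip` with its list unrolled: the sum over k of f (j + 1 + k) ·
  -- recip f (n - k).
  recipSum : FPS → ℕ → ℕ → ℤ
  recipSum f zero    j = f (suc j) * 1ℤ + 0ℤ
  recipSum f (suc n) j = f (suc j) * (- recipSum f n 0) + recipSum f n (suc j)

  -- `recip` unfolds to functions that are private to Defs.  Abstracting over the
  -- literal 0 turns the private accumulator call into one with a variable offset,
  -- which lets the left-hand side of `recipSum-correct` be inferred.
  mutual
    recip-suc : ∀ f n → recip f (suc n) ≡ - recipSum f n 0
    recip-suc f n with 0
    ... | j = cong -_ (recipSum-correct f n j)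

    recipSum-correct : ∀ f n j → _ ≡ recipSum f n j
    recipSum-correct f zero    j = refl
    recipSum-correct f (suc n) j =
      cong₂ _+_ (cong (λ x → f (suc j) * - x) (recipSum-correct f n 0))
                (recipSum-correct f n (suc j))

  recipSum-⊛ : ∀ f n j → recipSum f n j ≡ ((λ k → f (suc (j ℕ.+ k))) ⊛ recip f) n
  recipSum-⊛ f zero j =
    trans (ℤₚ.+-identityʳ _) (cong (λ k → f (suc k) * 1ℤ) (sym (ℕₚ.+-identityʳ j)))
  recipSum-⊛ f (suc n) j = begin
    f (suc j) * (- recipSum f n 0) + recipSum f n (suc j)
      ≡⟨ cong₂ _+_ (cong₂ (λ k x → f (suc k) * x) (sym (ℕₚ.+-identityʳ j)) (sym (recip-suc f n)))
                   (recipSum-⊛ f n (suc j)) ⟩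
    f (suc (j ℕ.+ 0)) * recip f (suc n) + ((λ k → f (suc (suc (j ℕ.+ k)))) ⊛ recip f) n
      ≡⟨ cong (_+_ (f (suc (j ℕ.+ 0)) * recip f (suc n)))
           (⊛-cong n {g = recip f} (λ k _ → cong (f ∘ suc) (sym (ℕₚ.+-suc j k))) (λ _ _ → refl)) ⟩
    f (suc (j ℕ.+ 0)) * recip f (suc n) + ((λ k → f (suc (j ℕ.+ suc k))) ⊛ recip f) n
      ≡⟨ ⊛-suc (λ k → f (suc (j ℕ.+ k))) (recip f) n ⟨
    ((λ k → f (suc (j ℕ.+ k))) ⊛ recip f) (suc n) ∎

  ⊛-recip : ∀ f → f 0 ≡ 1ℤ → ∀ n → (f ⊛ recip f) n ≡ oneS n
  ⊛-recip f f₀ zero    = trans (cong (_* 1ℤ) f₀) refl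
  ⊛-recip f f₀ (suc n) = begin
    (f ⊛ recip f) (suc n)
      ≡⟨ ⊛-suc f (recip f) n ⟩
    f 0 * recip f (suc n) + ((f ∘ suc) ⊛ recip f) n
      ≡⟨ cong₂ (λ x y → x * y + ((f ∘ suc) ⊛ recip f) n) f₀ (recip-suc f n) ⟩
    1ℤ * (- recipSum f n 0) + ((f ∘ suc) ⊛ recip f) n
      ≡⟨ cong₂ _+_ (ℤₚ.*-identityˡ (- recipSum f n 0)) (sym (recipSum-⊛ f n 0)) ⟩
    - recipSum f n 0 + recipSum f n 0
      ≡⟨ ℤₚ.+-inverseˡ (recipSum f n 0) ⟩
    0ℤ ∎

  -- Power series modulo q^(N+1) as a commutative ring.

  module Truncation (N : ℕ) where

    infix 4 _≈_

    -- A record and not a bare function type, so that `f` and `g` can be inferred from the type of a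
    -- proof.
    record _≈_ (f g : FPS) : Set where
      constructor agree
      field at : ∀ {i} → i ≤ N → f i ≡ g i
    open _≈_ public

    everywhere : ∀ {f g} → (∀ i → f i ≡ g i) → f ≈ g
    everywhere p = agree (λ {i} _ → p i)

    ring : CommutativeRing 0ℓ 0ℓ
    ring = record
      { Carrier = FPS ; _≈_ = _≈_ ; _+_ = _⊞_ ; _*_ = _⊛_ ; -_ = ⊟_ ; 0# = zeroS ; 1# = oneS
      ; isCommutativeRing = record
        { isRing = record
          { +-isAbelianGroup = record
            { isGroup = record
              { isMonoid = record
                { isSemigroup = record
                  { isMagma = record
                    { isEquivalence = record
                      { refl  = agree (λ _ → refl)
                      ; sym   = λ p → agree (λ i≤N → sym (at p i≤N))
                      ; trans = λ p q → agree (λ i≤N → trans (at p i≤N) (at q i≤N)) }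
                    ; ∙-cong = λ p q → agree (λ i≤N → cong₂ _+_ (at p i≤N) (at q i≤N)) }
                  ; assoc = λ f g h → everywhere (λ i → ℤₚ.+-assoc (f i) (g i) (h i)) }
                ; identity = (λ f → everywhere (λ i → ℤₚ.+-identityˡ (f i)))
                           , (λ f → everywhere (λ i → ℤₚ.+-identityʳ (f i))) }
              ; inverse = (λ f → everywhere (λ i → ℤₚ.+-inverseˡ (f i)))
                        , (λ f → everywhere (λ i → ℤₚ.+-inverseʳ (f i)))
              ; ⁻¹-cong = λ p → agree (λ i≤N → cong -_ (at p i≤N)) }
            ; comm = λ f g → everywhere (λ i → ℤₚ.+-comm (f i) (g i)) }
          ; *-cong = λ p q → agree (λ {i} i≤N → ⊛-cong i
              (λ k k≤i → at p (ℕₚ.≤-trans k≤i i≤N)) (λ k k≤i → at q (ℕₚ.≤-trans k≤i i≤N)))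
          ; *-assoc = λ f g h → everywhere (⊛-assoc f g h)
          ; *-identity = (λ f → everywhere (⊛-identityˡ f))
                       , (λ f → everywhere (λ i → trans (⊛-comm f oneS i) (⊛-identityˡ f i)))
          ; distrib = (λ f g h → everywhere (λ i → trans (⊛-comm f (g ⊞ h) i)
                        (trans (⊛-distribʳ f g h i) (cong₂ _+_ (⊛-comm g f i) (⊛-comm h f i)))))
                    , (λ f g h → everywhere (⊛-distribʳ f g h)) }
        ; *-comm = λ f g → everywhere (⊛-comm f g) } }

open PowerSeries

-- Sums of finitely supported families.

module Summation (R : CommutativeRing 0ℓ 0ℓ) where

  open CommutativeRing R
  open import Algebra.Properties.Ring ring using (-0#≈0#; -‿+-comm)
  open import Algebra.Properties.CommutativeSemigroup +-commutativeSemigroup using (interchange)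
  open import Relation.Binary.Reasoning.Setoid setoid

  ∑ : {A : Set} → List A → (A → Carrier) → Carrier
  ∑ []       f = 0#
  ∑ (x ∷ xs) f = f x + ∑ xs f

  module _ {A : Set} where

    ∑-cong-∈ : ∀ xs {f g : A → Carrier} → (∀ {x} → x ∈ xs → f x ≈ g x) → ∑ xs f ≈ ∑ xs g
    ∑-cong-∈ []       f≈g = refl
    ∑-cong-∈ (x ∷ xs) f≈g = +-cong (f≈g (here ≡.refl)) (∑-cong-∈ xs (f≈g ∘ there))

    ∑-cong : ∀ xs {f g : A → Carrier} → (∀ x → f x ≈ g x) → ∑ xs f ≈ ∑ xs g
    ∑-cong xs f≈g = ∑-cong-∈ xs (λ {x} _ → f≈g x)

    ∑-0 : ∀ (xs : List A) → ∑ xs (λ _ → 0#) ≈ 0#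
    ∑-0 []       = refl
    ∑-0 (x ∷ xs) = trans (+-identityˡ _) (∑-0 xs)

    ∑-+ : ∀ xs (f g : A → Carrier) → ∑ xs (λ x → f x + g x) ≈ ∑ xs f + ∑ xs g
    ∑-+ []       f g = sym (+-identityˡ 0#)
    ∑-+ (x ∷ xs) f g = trans (+-congˡ (∑-+ xs f g)) (interchange (f x) (g x) _ _)

    ∑-neg : ∀ xs (f : A → Carrier) → ∑ xs (λ x → - f x) ≈ - ∑ xs f
    ∑-neg []       f = sym -0#≈0#
    ∑-neg (x ∷ xs) f = trans (+-congˡ (∑-neg xs f)) (-‿+-comm (f x) _)

    ∑-*ˡ : ∀ c xs (f : A → Carrier) → ∑ xs (λ x → c * f x) ≈ c * ∑ xs f
    ∑-*ˡ c []       f = sym (zeroʳ c)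
    ∑-*ˡ c (x ∷ xs) f = trans (+-congˡ (∑-*ˡ c xs f)) (sym (distribˡ c (f x) _))

    ∑-++ : ∀ xs ys (f : A → Carrier) → ∑ (xs ++ ys) f ≈ ∑ xs f + ∑ ys f
    ∑-++ []       ys f = sym (+-identityˡ _)
    ∑-++ (x ∷ xs) ys f = trans (+-congˡ (∑-++ xs ys f)) (sym (+-assoc (f x) _ _))

  ∑-map : ∀ {A B : Set} (φ : A → B) xs (f : B → Carrier) → ∑ (map φ xs) f ≡ ∑ xs (f ∘ φ)
  ∑-map φ []       f = ≡.refl
  ∑-map φ (x ∷ xs) f = ≡.cong (_+_ (f (φ x))) (∑-map φ xs f)

  ∑-swap : ∀ {A B : Set} xs ys (f : A → B → Carrier) →
           ∑ xs (λ x → ∑ ys (f x)) ≈ ∑ ys (λ y → ∑ xs (λ x → f x y))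
  ∑-swap []       ys f = sym (∑-0 ys)
  ∑-swap (x ∷ xs) ys f = trans (+-congˡ (∑-swap xs ys f)) (sym (∑-+ ys (f x) _))

  ∑-cartesianProduct : ∀ {A B : Set} xs ys (f : A → Carrier) (g : B → Carrier) →
                       ∑ (cartesianProduct xs ys) (λ (x , y) → f x * g y) ≈ ∑ xs f * ∑ ys g
  ∑-cartesianProduct []       ys f g = sym (zeroˡ _)
  ∑-cartesianProduct (x ∷ xs) ys f g = begin
    ∑ (map (x ,_) ys ++ cartesianProduct xs ys) h
      ≈⟨ ∑-++ (map (x ,_) ys) (cartesianProduct xs ys) h ⟩
    ∑ (map (x ,_) ys) h + ∑ (cartesianProduct xs ys) h
      ≈⟨ +-cong (trans (reflexive (∑-map (x ,_) ys h)) (∑-*ˡ (f x) ys g)) (∑-cartesianProduct xs ys f g) ⟩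
    f x * ∑ ys g + ∑ xs f * ∑ ys g
      ≈⟨ distribʳ (∑ ys g) (f x) (∑ xs f) ⟨
    (f x + ∑ xs f) * ∑ ys g ∎
    where h = λ (x , y) → f x * g y

  module _ {A : Set} (_≟_ : DecidableEquality A) where

    open DecMembership _≟_ using (_∈?_)

    private
      only : A → Carrier → A → Carrier
      only x v y = if does (x ≟ y) then v else 0#

      only-≢ : ∀ {x y} v → x ≢ y → only x v y ≈ 0#
      only-≢ {x} {y} v x≢y with x ≟ y
      ... | yes x≡y = contradiction x≡y x≢y
      ... | no  _   = refl

      only-≡ : ∀ x v → only x v x ≈ v
      only-≡ x v with x ≟ x
      ... | yes _  = refl
      ... | no x≢x = contradiction ≡.refl x≢x

      only-sym : ∀ (f : A → Carrier) x y → only x (f x) y ≈ only y (f y) x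
      only-sym f x y with x ≟ y | y ≟ x
      ... | yes ≡.refl | yes _  = refl
      ... | yes ≡.refl | no y≢x = contradiction ≡.refl y≢x
      ... | no x≢y | yes ≡.refl = contradiction ≡.refl x≢y
      ... | no _   | no _       = refl

      ∑-only-∉ : ∀ {x} v ys → All (x ≢_) ys → ∑ ys (only x v) ≈ 0#
      ∑-only-∉ v []       []            = refl
      ∑-only-∉ v (y ∷ ys) (x≢y ∷ x∉ys) =
        trans (+-cong (only-≢ v x≢y) (∑-only-∉ v ys x∉ys)) (+-identityˡ 0#)

      ∑-only-∈ : ∀ {x} v ys → Unique ys → x ∈ ys → ∑ ys (only x v) ≈ v
      ∑-only-∈ v (y ∷ ys) (y∉ys ∷ _) (here ≡.refl) =
        trans (+-cong (only-≡ y v) (∑-only-∉ v ys y∉ys)) (+-identityʳ v)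
      ∑-only-∈ v (y ∷ ys) (y∉ys ∷ u) (there x∈ys) =
        trans (+-cong (only-≢ v (λ x≡y → All.lookup y∉ys x∈ys (≡.sym x≡y))) (∑-only-∈ v ys u x∈ys))
              (+-identityˡ v)

      ∑-only : ∀ (f : A → Carrier) x ys → Unique ys → (∀ {y} → y ∉ ys → f y ≈ 0#) →
               ∑ ys (only x (f x)) ≈ f x
      ∑-only f x ys u vanish with x ∈? ys
      ... | yes x∈ys = ∑-only-∈ (f x) ys u x∈ys
      ... | no  x∉ys = trans (∑-only-∉ (f x) ys (All.tabulate (λ { y∈ys ≡.refl → x∉ys y∈ys })))
                             (sym (vanish x∉ys))

    -- A Kronecker delta expands each side into the double sum of `f` over the diagonal pairs of
    -- `xs` and `ys`. After an exchange of the order of summation the two expansions coincide.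
    ∑-support-irrelevant : ∀ (f : A → Carrier) {xs ys} → Unique xs → Unique ys →
                           (∀ {x} → x ∉ xs → f x ≈ 0#) → (∀ {y} → y ∉ ys → f y ≈ 0#) →
                           ∑ xs f ≈ ∑ ys f
    ∑-support-irrelevant f {xs} {ys} uxs uys vxs vys = begin
      ∑ xs f                                 ≈⟨ ∑-cong xs (λ x → sym (∑-only f x ys uys vys)) ⟩
      ∑ xs (λ x → ∑ ys (only x (f x)))       ≈⟨ ∑-swap xs ys (λ x → only x (f x)) ⟩
      ∑ ys (λ y → ∑ xs (λ x → only x (f x) y)) ≈⟨ ∑-cong ys (λ y → ∑-cong xs (λ x → only-sym f x y)) ⟩
      ∑ ys (λ y → ∑ xs (only y (f y)))       ≈⟨ ∑-cong ys (λ y → ∑-only f y xs uxs vxs) ⟩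
      ∑ ys f                                 ∎

  -- Gives meaning to sums over ℤ, ℤ × ℤ or a disjoint union without an order of summation;
  -- `hasSum-unique` shows that the value does not depend on the list.
  record HasSum {A : Set} (f : A → Carrier) (s : Carrier) : Set where
    field
      support : List A
      unique  : Unique support
      vanish  : ∀ {x} → x ∉ support → f x ≈ 0#
      total   : ∑ support f ≈ s
  open HasSum

  module _ {A : Set} where

    hasSum-cong : ∀ {f g : A → Carrier} {s t} → (∀ x → f x ≈ g x) → s ≈ t → HasSum f s → HasSum g t
    hasSum-cong f≈g s≈t H = record
      { support = support H
      ; unique  = unique H
      ; vanish  = λ {x} x∉ → trans (sym (f≈g x)) (vanish H x∉)
      ; total   = trans (∑-cong (support H) (λ x → sym (f≈g x))) (trans (total H) s≈t) }

    hasSum-neg : ∀ {f : A → Carrier} {s} → HasSum f s → HasSum (λ x → - f x) (- s)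
    hasSum-neg {f} H = record
      { support = support H
      ; unique  = unique H
      ; vanish  = λ x∉ → trans (-‿cong (vanish H x∉)) -0#≈0#
      ; total   = trans (∑-neg (support H) f) (-‿cong (total H)) }

    hasSum-*ˡ : ∀ {f : A → Carrier} {s} c → HasSum f s → HasSum (λ x → c * f x) (c * s)
    hasSum-*ˡ {f} c H = record
      { support = support H
      ; unique  = unique H
      ; vanish  = λ x∉ → trans (*-congˡ (vanish H x∉)) (zeroʳ c)
      ; total   = trans (∑-*ˡ c (support H) f) (*-congˡ (total H)) }

  -- Injectivity keeps the image list free of repetitions; surjectivity transports the vanishing to
  -- every index of `B`.
  hasSum-bij : ∀ {A B : Set} (φ : A → B) → (∀ {x y} → φ x ≡ φ y → x ≡ y) → (∀ y → ∃ λ x → φ x ≡ y) →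
               ∀ {f : B → Carrier} {s} → HasSum (f ∘ φ) s → HasSum f s
  hasSum-bij φ injective surjective {f} H = record
    { support = map φ (support H)
    ; unique  = Unique.map⁺ injective (unique H)
    ; vanish  = λ {y} y∉ → vanishes y y∉ (surjective y)
    ; total   = trans (reflexive (∑-map φ (support H) f)) (total H) }
    where
    vanishes : ∀ y → y ∉ map φ (support H) → (∃ λ x → φ x ≡ y) → f y ≈ 0#
    vanishes y y∉ (x , ≡.refl) = vanish H (λ x∈ → y∉ (∈-map⁺ φ x∈))

  hasSum-⊎ : ∀ {A B : Set} {f : A ⊎ B → Carrier} {s t} →
             HasSum (f ∘ inj₁) s → HasSum (f ∘ inj₂) t → HasSum f (s + t)
  hasSum-⊎ {f = f} H K = record
    { support = map inj₁ (support H) ++ map inj₂ (support K)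
    ; unique  = Unique.++⁺ (Unique.map⁺ (λ { ≡.refl → ≡.refl }) (unique H))
                           (Unique.map⁺ (λ { ≡.refl → ≡.refl }) (unique K)) disjoint
    ; vanish  = λ { {inj₁ x} x∉ → vanish H (λ x∈ → x∉ (∈-++⁺ˡ (∈-map⁺ inj₁ x∈)))
                  ; {inj₂ y} y∉ → vanish K (λ y∈ → y∉ (∈-++⁺ʳ _ (∈-map⁺ inj₂ y∈))) }
    ; total   = trans (∑-++ (map inj₁ (support H)) _ f)
                      (+-cong (trans (reflexive (∑-map inj₁ (support H) f)) (total H))
                              (trans (reflexive (∑-map inj₂ (support K) f)) (total K))) }
    where
    disjoint : ∀ {z} → ¬ (z ∈ map inj₁ (support H) × z ∈ map inj₂ (support K))
    disjoint (z∈₁ , z∈₂) with ∈-map⁻ inj₁ z∈₁ | ∈-map⁻ inj₂ z∈₂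
    ... | _ , _ , ≡.refl | _ , _ , ()

  hasSum-* : ∀ {A B : Set} {f : A → Carrier} {g : B → Carrier} {s t} →
             DecidableEquality A →
             HasSum f s → HasSum g t → HasSum (λ ((x , y) : A × B) → f x * g y) (s * t)
  hasSum-* {f = f} {g} _≟_ H K = record
    { support = cartesianProduct (support H) (support K)
    ; unique  = Unique.cartesianProduct⁺ (unique H) (unique K)
    ; vanish  = λ { {x , y} xy∉ → vanishes x y xy∉ }
    ; total   = trans (∑-cartesianProduct (support H) (support K) f g) (*-cong (total H) (total K)) }
    where
    open DecMembership _≟_ using (_∈?_)
    vanishes : ∀ x y → (x , y) ∉ cartesianProduct (support H) (support K) → f x * g y ≈ 0#
    -- A pair outside the rectangle has a coordinate outside its own support. Deciding which one is
    -- where decidable equality on `A` enters.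
    vanishes x y xy∉ with x ∈? support H
    ... | yes x∈ = trans (*-congˡ (vanish K (λ y∈ → xy∉ (∈-cartesianProduct⁺ x∈ y∈)))) (zeroʳ _)
    ... | no  x∉ = trans (*-congʳ (vanish H x∉)) (zeroˡ _)

  module _ {A : Set} (_≟_ : DecidableEquality A) where

    hasSum-unique : ∀ {f : A → Carrier} {s t} → HasSum f s → HasSum f t → s ≈ t
    hasSum-unique {f} H K = trans (sym (total H))
      (trans (∑-support-irrelevant _≟_ f (unique H) (unique K) (vanish H) (vanish K)) (total K))

    hasSum-+ : ∀ {f g : A → Carrier} {s t} → HasSum f s → HasSum g t → HasSum (λ x → f x + g x) (s + t)
    hasSum-+ {f} {g} H K = record
      { support = both
      ; unique  = both!
      ; vanish  = λ x∉ → trans (+-cong (vanishH x∉) (vanishK x∉)) (+-identityˡ 0#)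
      ; total   = trans (∑-+ both f g) (+-cong
          (trans (∑-support-irrelevant _≟_ f both! (unique H) vanishH (vanish H)) (total H))
          (trans (∑-support-irrelevant _≟_ g both! (unique K) vanishK (vanish K)) (total K))) }
      where
      both = deduplicate _≟_ (support H ++ support K)
      both! = DecUnique.deduplicate-! _≟_ (support H ++ support K)
      vanishH : ∀ {x} → x ∉ both → f x ≈ 0#
      vanishH x∉ = vanish H (λ x∈ → x∉ (∈-deduplicate⁺ _≟_ (∈-++⁺ˡ x∈)))
      vanishK : ∀ {x} → x ∉ both → g x ≈ 0#
      vanishK x∉ = vanish K (λ x∈ → x∉ (∈-deduplicate⁺ _≟_ (∈-++⁺ʳ (support H) x∈)))

-- Signs, quadratic exponents and finite ranges of integers.

module Quadratics where

  open import Data.Integer using (-_; _+_; _*_; _-_)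
  open import Relation.Binary.PropositionalEquality using (refl; sym; trans; cong; cong₂; subst)

  parityℕ : ℕ → Sign
  parityℕ zero    = Sign.+
  parityℕ (suc n) = opposite (parityℕ n)

  parity : ℤ → Sign
  parity i = parityℕ ∣ i ∣

  parity-suc : ∀ i → parity (ℤ.suc i) ≡ opposite (parity i)
  parity-suc (+ n)          = refl
  parity-suc -[1+ zero ]    = refl
  parity-suc -[1+ suc n ]   = sym (Signₚ.opposite-involutive _)

  parity-pred : ∀ i → parity (ℤ.pred i) ≡ opposite (parity i)
  parity-pred i = begin
    parity (ℤ.pred i)                       ≡⟨ Signₚ.opposite-involutive _ ⟨
    opposite (opposite (parity (ℤ.pred i))) ≡⟨ cong opposite (parity-suc (ℤ.pred i)) ⟨
    opposite (parity (ℤ.suc (ℤ.pred i)))    ≡⟨ cong (λ j → opposite (parity j)) (ℤₚ.suc-pred i) ⟩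
    opposite (parity i)                     ∎
    where open ≡.≡-Reasoning

  opposite-* : ∀ s t → opposite s Sign.* t ≡ opposite (s Sign.* t)
  opposite-* Sign.+ t = refl
  opposite-* Sign.- t = sym (Signₚ.opposite-involutive t)

  parity-+ : ∀ i j → parity (i + j) ≡ parity i Sign.* parity j
  parity-+ (+ zero)       j = cong parity (ℤₚ.+-identityˡ j)
  parity-+ (+ suc n)      j = begin
    parity (+ suc n + j)                 ≡⟨ cong parity (ℤₚ.suc-+ n j) ⟩
    parity (ℤ.suc (+ n + j))             ≡⟨ parity-suc (+ n + j) ⟩
    opposite (parity (+ n + j))          ≡⟨ cong opposite (parity-+ (+ n) j) ⟩
    opposite (parityℕ n Sign.* parity j) ≡⟨ opposite-* (parityℕ n) (parity j) ⟨
    opposite (parityℕ n) Sign.* parity j ∎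
    where open ≡.≡-Reasoning
  parity-+ -[1+ zero ]    j = parity-pred j
  parity-+ -[1+ suc n ]   j = begin
    parity (-[1+ suc n ] + j)              ≡⟨ cong parity (ℤₚ.pred-+ -[1+ n ] j) ⟩
    parity (ℤ.pred (-[1+ n ] + j))         ≡⟨ parity-pred (-[1+ n ] + j) ⟩
    opposite (parity (-[1+ n ] + j))       ≡⟨ cong opposite (parity-+ -[1+ n ] j) ⟩
    opposite (parityℕ (suc n) Sign.* parity j) ≡⟨ opposite-* (parityℕ (suc n)) (parity j) ⟨
    opposite (parityℕ (suc n)) Sign.* parity j ∎
    where open ≡.≡-Reasoning

  parity-double : ∀ i → parity (i + i) ≡ Sign.+
  parity-double i = trans (parity-+ i i) (Signₚ.s*s≡+ (parity i))

  parity-congruent : ∀ {i} j k → i ≡ j + (k + k) → parity i ≡ parity j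
  parity-congruent j k refl =
    trans (parity-+ j (k + k)) (trans (cong (parity j Sign.*_) (parity-double k)) (Signₚ.*-identityʳ _))

  infixr 8 _^ˢ_

  _^ˢ_ : Sign → ℤ → Sign
  Sign.+ ^ˢ i = Sign.+
  Sign.- ^ˢ i = parity i

  ^ˢ-+ : ∀ s i j → s ^ˢ (i + j) ≡ s ^ˢ i Sign.* s ^ˢ j
  ^ˢ-+ Sign.+ i j = refl
  ^ˢ-+ Sign.- i j = parity-+ i j

  ^ˢ-congruent : ∀ s {i} j k → i ≡ j + (k + k) → s ^ˢ i ≡ s ^ˢ j
  ^ˢ-congruent Sign.+ j k eq = refl
  ^ˢ-congruent Sign.- j k eq = parity-congruent j k eq

  ^ˢ-suc : ∀ s i → s ^ˢ (i + 1ℤ) ≡ s Sign.* s ^ˢ i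
  ^ˢ-suc Sign.+ i = refl
  ^ˢ-suc Sign.- i = trans (parity-+ i 1ℤ) (Signₚ.*-comm (parity i) Sign.-)

  quad : ℤ → ℤ → ℤ → ℤ → ℤ
  quad A B C t = A * (t * t) + B * t + C

  0≤+ : ∀ {i j} → 0ℤ ℤ.≤ i → 0ℤ ℤ.≤ j → 0ℤ ℤ.≤ i + j
  0≤+ 0≤i 0≤j = ℤₚ.+-mono-≤ 0≤i 0≤j

  0≤* : ∀ {i j} → 0ℤ ℤ.≤ i → 0ℤ ℤ.≤ j → 0ℤ ℤ.≤ i * j
  0≤* {+ m} {+ n} (+≤+ _) (+≤+ _) = subst (0ℤ ℤ.≤_) (ℤₚ.pos-* m n) (+≤+ z≤n)

  -- Sufficient conditions, checkable on coefficients, for a quadratic to be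
  -- non-negative on ℤ and to grow at least linearly: they say that the expansions
  -- around t = 1 and t = -1 have non-negative coefficients.
  record Admissible (A B C : ℤ) : Set where
    constructor admissible
    field
      A≥1     : 0ℤ ℤ.≤ A - 1ℤ
      C≥0     : 0ℤ ℤ.≤ C
      right₁  : 0ℤ ℤ.≤ A + A + B
      right₀  : 0ℤ ℤ.≤ A + B + C
      left₁   : 0ℤ ℤ.≤ A + A - B
      left₀   : 0ℤ ℤ.≤ A - B + C

  admissible? : ∀ A B C → Dec (Admissible A B C)
  admissible? A B C = map′
    (λ (a , b , c , d , e , f) → admissible a b c d e f)
    (λ (admissible a b c d e f) → a , b , c , d , e , f)
    (0ℤ ℤ.≤? A - 1ℤ ×-dec 0ℤ ℤ.≤? C ×-dec 0ℤ ℤ.≤? A + A + B ×-dec 0ℤ ℤ.≤? A + B + C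
      ×-dec 0ℤ ℤ.≤? A + A - B ×-dec 0ℤ ℤ.≤? A - B + C)

  private
    0≤k*k-k : ∀ k → 0ℤ ℤ.≤ + k * + k - + k
    0≤k*k-k zero    = +≤+ z≤n
    0≤k*k-k (suc k) = subst (0ℤ ℤ.≤_) (expand (+ k)) (0≤+ (0≤* {+ k} {+ k} (+≤+ z≤n) (+≤+ z≤n)) (+≤+ {0} {k} z≤n))
      where
      expand : ∀ x → x * x + x ≡ (1ℤ + x) * (1ℤ + x) - (1ℤ + x)
      expand = solve-∀

    k≤quad : ∀ {A B C} k → 0ℤ ℤ.≤ A - 1ℤ → 0ℤ ℤ.≤ B → 0ℤ ℤ.≤ C → + k ℤ.≤ quad A B C (+ k)
    k≤quad {A} {B} {C} k A≥1 B≥0 C≥0 = ℤₚ.0≤i-j⇒j≤i (subst (0ℤ ℤ.≤_) (expand A B C (+ k))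
      (0≤+ (0≤+ (0≤+ (0≤k*k-k k) (0≤* A≥1 (0≤* 0≤k 0≤k))) (0≤* B≥0 0≤k)) C≥0))
      where
      0≤k : 0ℤ ℤ.≤ + k
      0≤k = +≤+ z≤n
      expand : ∀ A B C x → x * x - x + (A - 1ℤ) * (x * x) + B * x + C
                         ≡ A * (x * x) + B * x + C - x
      expand = solve-∀

    drop-1 : ∀ i → 1ℤ ℤ.≤ i + 1ℤ → 0ℤ ℤ.≤ i
    drop-1 i 1≤i+1 = subst (0ℤ ℤ.≤_) (cancel i) (ℤₚ.i≤j⇒0≤j-i 1≤i+1)
      where
      cancel : ∀ x → x + 1ℤ - 1ℤ ≡ x
      cancel = solve-∀

  -- At distance k beyond 1 or -1 the expansion there has leading coefficient at least 1 and no
  -- negative coefficient, so its value is at least k. The extra 1 is the distance from 0 to ±1, and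
  -- it is attained: 3t² - 3t vanishes at t = 1.
  ∣t∣≤quad+1 : ∀ {A B C} → Admissible A B C → ∀ t → + ∣ t ∣ ℤ.≤ quad A B C t + 1ℤ
  ∣t∣≤quad+1 {A} {B} {C} adm (+ zero) =
    subst (0ℤ ℤ.≤_) (expand A B C) (0≤+ C≥0 (+≤+ z≤n))
    where
    open Admissible adm
    expand : ∀ A B C → C + 1ℤ ≡ A * (0ℤ * 0ℤ) + B * 0ℤ + C + 1ℤ
    expand = solve-∀
  ∣t∣≤quad+1 {A} {B} {C} adm (+ suc k) =
    subst (+ suc k ℤ.≤_) (expand A B C (+ k)) (ℤₚ.+-monoʳ-≤ 1ℤ (k≤quad {A} k A≥1 right₁ right₀))
    where
    open Admissible adm
    expand : ∀ A B C x → 1ℤ + (A * (x * x) + (A + A + B) * x + (A + B + C))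
                       ≡ A * ((1ℤ + x) * (1ℤ + x)) + B * (1ℤ + x) + C + 1ℤ
    expand = solve-∀
  ∣t∣≤quad+1 {A} {B} {C} adm -[1+ k ] =
    subst (+ suc k ℤ.≤_) (expand A B C (+ k)) (ℤₚ.+-monoʳ-≤ 1ℤ (k≤quad {A} k A≥1 left₁ left₀))
    where
    open Admissible adm
    expand : ∀ A B C x → 1ℤ + (A * (x * x) + (A + A - B) * x + (A - B + C))
                       ≡ A * ((- (1ℤ + x)) * (- (1ℤ + x))) + B * (- (1ℤ + x)) + C + 1ℤ
    expand = solve-∀

  0≤quad : ∀ {A B C} → Admissible A B C → ∀ t → 0ℤ ℤ.≤ quad A B C t
  0≤quad {A} {B} {C} adm (+ zero) = subst (0ℤ ℤ.≤_) (expand A B C) (Admissible.C≥0 adm)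
    where
    expand : ∀ A B C → C ≡ A * (0ℤ * 0ℤ) + B * 0ℤ + C
    expand = solve-∀
  0≤quad adm t@(+ suc k)  = drop-1 _ (ℤₚ.≤-trans (+≤+ (s≤s z≤n)) (∣t∣≤quad+1 adm t))
  0≤quad adm t@(-[1+ k ]) = drop-1 _ (ℤₚ.≤-trans (+≤+ (s≤s z≤n)) (∣t∣≤quad+1 adm t))

  interval : ℕ → List ℤ
  interval K = map +_ (upTo (suc K)) ++ map -[1+_] (upTo K)

  interval-unique : ∀ K → Unique (interval K)
  interval-unique K = Unique.++⁺ (Unique.map⁺ ℤₚ.+-injective (Unique.upTo⁺ (suc K)))
    (Unique.map⁺ ℤₚ.-[1+-injective (Unique.upTo⁺ K)) disjoint
    where
    disjoint : ∀ {z} → ¬ (z ∈ map +_ (upTo (suc K)) × z ∈ map -[1+_] (upTo K))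
    disjoint (z∈₁ , z∈₂) with ∈-map⁻ +_ z∈₁ | ∈-map⁻ -[1+_] z∈₂
    ... | _ , _ , refl | _ , _ , ()

  ∈-interval : ∀ {K} t → ∣ t ∣ ℕ.≤ K → t ∈ interval K
  ∈-interval (+ n)    n≤K = ∈-++⁺ˡ (∈-map⁺ +_ (∈-upTo⁺ (s≤s n≤K)))
  ∈-interval -[1+ n ] n<K = ∈-++⁺ʳ (map +_ (upTo (suc _))) (∈-map⁺ -[1+_] (∈-upTo⁺ n<K))

  ∉-interval : ∀ {K} t → t ∉ interval K → K ℕ.< ∣ t ∣
  ∉-interval t t∉ = ℕₚ.≰⇒> (λ ∣t∣≤K → t∉ (∈-interval t ∣t∣≤K))

open Quadratics

-- Theta series and infinite products over a ring in which q^n = 0 for n > N.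

record TruncatedPowers : Set₁ where
  field commutativeRing : CommutativeRing 0ℓ 0ℓ
  open CommutativeRing commutativeRing
  field
    N           : ℕ
    q           : ℕ → Carrier
    q-0         : q 0 ≈ 1#
    q-+         : ∀ m n → q (m ℕ.+ n) ≈ q m * q n
    q-vanish    : ∀ {n} → N ℕ.< n → q n ≈ 0#
    geo         : ℕ → Carrier
    geo-inverse : ∀ {n} → 1 ℕ.≤ n → geo n * (1# - q n) ≈ 1#
    -- Absence of 2-torsion, so that a sum equal to its own negative is zero.
    x+x≈0⇒x≈0   : ∀ {x} → x + x ≈ 0# → x ≈ 0#

module Theta (T : TruncatedPowers) where

  open TruncatedPowers T
  open CommutativeRing commutativeRing
  open Summation commutativeRing
  open import Algebra.Properties.Ring ring
    using (-0#≈0#; -‿distribˡ-*; -‿distribʳ-*; -‿involutive)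
  open import Relation.Binary.Reasoning.Setoid setoid
  module Solver = SemiringSolver commutativeSemiring
  open Solver using (solve; _:=_; _:+_; _:*_; con)

  infixr 8 _◃_

  _◃_ : Sign → Carrier → Carrier
  Sign.+ ◃ x = x
  Sign.- ◃ x = - x

  ◃-cong : ∀ s {x y} → x ≈ y → s ◃ x ≈ s ◃ y
  ◃-cong Sign.+ x≈y = x≈y
  ◃-cong Sign.- x≈y = -‿cong x≈y

  ◃-* : ∀ s t x y → (s ◃ x) * (t ◃ y) ≈ (s Sign.* t) ◃ (x * y)
  ◃-* Sign.+ Sign.+ x y = refl
  ◃-* Sign.+ Sign.- x y = sym (-‿distribʳ-* x y)
  ◃-* Sign.- Sign.+ x y = sym (-‿distribˡ-* x y)
  ◃-* Sign.- Sign.- x y = begin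
    - x * - y     ≈⟨ -‿distribˡ-* x (- y) ⟨
    - (x * - y)   ≈⟨ -‿cong (-‿distribʳ-* x y) ⟨
    - (- (x * y)) ≈⟨ -‿involutive (x * y) ⟩
    x * y         ∎

  ◃-0 : ∀ s → s ◃ 0# ≈ 0#
  ◃-0 Sign.+ = refl
  ◃-0 Sign.- = -0#≈0#

  ◃-opposite : ∀ s x → opposite s ◃ x ≈ - (s ◃ x)
  ◃-opposite Sign.+ x = refl
  ◃-opposite Sign.- x = sym (-‿involutive x)

  -- Junk value 0 at negative exponents.
  mono : ℤ → Carrier
  mono (+ n)    = q n
  mono -[1+ n ] = 0#

  -- With one negative exponent the left side may be a genuine power while the right side is 0. This
  -- is why non-negativity of exponents accompanies every multiplication of theta series.
  mono-+ : ∀ {d e} → 0ℤ ℤ.≤ d → 0ℤ ℤ.≤ e → mono (d ℤ.+ e) ≈ mono d * mono e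
  mono-+ {+ m} {+ n} (+≤+ _) (+≤+ _) = q-+ m n

  mono-vanish : ∀ {e} → + N ℤ.< e → mono e ≈ 0#
  mono-vanish (ℤ.+<+ N<e) = q-vanish N<e

  term : Sign → ℤ → Carrier
  term s e = s ◃ mono e

  term-* : ∀ s t {d e} → 0ℤ ℤ.≤ d → 0ℤ ℤ.≤ e → term s d * term t e ≈ term (s Sign.* t) (d ℤ.+ e)
  term-* s t 0≤d 0≤e = trans (◃-* s t _ _) (◃-cong (s Sign.* t) (sym (mono-+ 0≤d 0≤e)))

  term-≡ : ∀ {s t d e} → s ≡ t → d ≡ e → term s d ≈ term t e
  term-≡ ≡.refl ≡.refl = refl

  quad-vanish : ∀ {A B C} → Admissible A B C → ∀ s t → suc N ℕ.< ∣ t ∣ → term s (quad A B C t) ≈ 0#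
  quad-vanish {A} {B} {C} adm s t N+1<∣t∣ = trans (◃-cong s (mono-vanish N<quad)) (◃-0 s)
    where
    N<quad : + N ℤ.< quad A B C t
    N<quad = ≡.subst (+ N ℤ.<_) (cancel (quad A B C t))
      (ℤₚ.+-monoˡ-< -1ℤ (ℤₚ.<-≤-trans (ℤ.+<+ N+1<∣t∣) (∣t∣≤quad+1 adm t)))
      where
      cancel : ∀ i → i ℤ.+ 1ℤ ℤ.+ -1ℤ ≡ i
      cancel = solve-∀

  -- The radius N + 1 suffices because `∣t∣` exceeds an admissible exponent by at most 1.
  theta : (ℤ → Sign) → ℤ → ℤ → ℤ → Carrier
  theta σ A B C = ∑ (interval (suc N)) (λ t → term (σ t) (quad A B C t))

  theta-hasSum : ∀ σ {A B C} → Admissible A B C →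
                 HasSum (λ t → term (σ t) (quad A B C t)) (theta σ A B C)
  theta-hasSum σ adm = record
    { support = interval (suc N)
    ; unique  = interval-unique (suc N)
    ; vanish  = λ {t} t∉ → quad-vanish adm (σ t) t (∉-interval t t∉)
    ; total   = refl }

  hasSum-shift : ∀ c {f : ℤ → Carrier} {s} → HasSum f s → HasSum (λ t → f (t ℤ.+ c)) s
  hasSum-shift c {f} H = hasSum-bij (ℤ._- c) injective (λ t → t ℤ.+ c , cancel t c)
    (hasSum-cong (λ t → reflexive (≡.cong f (≡.sym (cancel′ t c)))) refl H)
    where
    cancel : ∀ t c → t ℤ.+ c ℤ.- c ≡ t
    cancel = solve-∀
    cancel′ : ∀ t c → t ℤ.- c ℤ.+ c ≡ t
    cancel′ = solve-∀
    injective : ∀ {t u} → t ℤ.- c ≡ u ℤ.- c → t ≡ u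
    injective {t} {u} eq = ≡.trans (≡.sym (cancel′ t c)) (≡.trans (≡.cong (ℤ._+ c) eq) (cancel′ u c))

  hasSum-reflect : ∀ c {f : ℤ → Carrier} {s} → HasSum f s → HasSum (λ t → f (c ℤ.- t)) s
  hasSum-reflect c {f} H = hasSum-bij (λ t → c ℤ.- t) injective (λ t → c ℤ.- t , cancel t c)
    (hasSum-cong (λ t → reflexive (≡.cong f (≡.sym (cancel t c)))) refl H)
    where
    cancel : ∀ t c → c ℤ.- (c ℤ.- t) ≡ t
    cancel = solve-∀
    injective : ∀ {t u} → c ℤ.- t ≡ c ℤ.- u → t ≡ u
    injective {t} {u} eq = ≡.trans (≡.sym (cancel t c)) (≡.trans (≡.cong (ℤ._-_ c) eq) (cancel u c))

  -- The reflection t ↦ c - t permutes ℤ, so the sum equals its own negative.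
  antisymmetric⇒0 : ∀ c {f : ℤ → Carrier} {s} → (∀ t → f (c ℤ.- t) ≈ - f t) → HasSum f s → s ≈ 0#
  antisymmetric⇒0 c {f} {s} anti H = x+x≈0⇒x≈0 (begin
    s + s   ≈⟨ +-congˡ (hasSum-unique ℤₚ._≟_ (hasSum-reflect c H)
                         (hasSum-cong (λ t → sym (anti t)) refl (hasSum-neg H))) ⟩
    s - s   ≈⟨ -‿inverseʳ s ⟩
    0#      ∎)

  -- The finite symbol (-s q^r; q^k)_j; the sign `Sign.-` gives the usual (q^r; q^k)_j.
  prod : Sign → ℕ → ℕ → ℕ → Carrier
  prod s r k zero    = 1#
  prod s r k (suc j) = prod s r k j * (1# + s ◃ q (r ℕ.+ k ℕ.* j))

  prod∞ : Sign → ℕ → ℕ → Carrier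
  prod∞ s r k = prod s r k (suc N)

  m≤r+k*m : ∀ r {k} → 1 ℕ.≤ k → ∀ m → m ℕ.≤ r ℕ.+ k ℕ.* m
  m≤r+k*m r {suc k} _ m = ℕₚ.≤-trans (ℕₚ.m≤m+n m (k ℕ.* m)) (ℕₚ.m≤n+m (m ℕ.+ k ℕ.* m) r)

  -- A factor with index i > N has exponent at least i, hence equals 1 in this ring.
  prod-stable : ∀ s r {k} → 1 ℕ.≤ k → ∀ {j} → suc N ℕ.≤ j → prod s r k j ≈ prod∞ s r k
  prod-stable s r {k} 1≤k {j} N<j = ≡.subst (λ i → prod s r k i ≈ prod∞ s r k)
    (ℕₚ.m∸n+n≡m N<j) (stable (j ℕ.∸ suc N))
    where
    stable : ∀ d → prod s r k (d ℕ.+ suc N) ≈ prod∞ s r k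
    stable zero    = refl
    stable (suc d) = begin
      prod s r k i * (1# + s ◃ q (r ℕ.+ k ℕ.* i))
        ≈⟨ *-congˡ (+-congˡ (trans (◃-cong s (q-vanish (ℕₚ.≤-trans (ℕₚ.m≤n+m (suc N) d)
             (m≤r+k*m r 1≤k i)))) (◃-0 s))) ⟩
      prod s r k i * (1# + 0#) ≈⟨ *-congˡ (+-identityʳ 1#) ⟩
      prod s r k i * 1#        ≈⟨ *-identityʳ _ ⟩
      prod s r k i             ≈⟨ stable d ⟩
      prod∞ s r k              ∎
      where i = d ℕ.+ suc N

  -- (q^w;q^w)_j is inverted by `recips w j`; the value 0 at negative j makes
  -- `recips-pred` hold at m = 0 as well.
  recips : ℕ → ℤ → Carrier
  recips w (+ zero)   = 1#
  recips w (+ suc j)  = recips w (+ j) * geo (w ℕ.+ w ℕ.* j)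
  recips w -[1+ j ]   = 0#

  recips-inverse : ∀ {w} → 1 ℕ.≤ w → ∀ j → prod Sign.- w w j * recips w (+ j) ≈ 1#
  recips-inverse 1≤w zero = *-identityˡ 1#
  recips-inverse {w} 1≤w (suc j) = begin
    (x * y) * (z * g) ≈⟨ solve 4 (λ x y z g → (x :* y) :* (z :* g) := (x :* z) :* (g :* y)) refl x y z g ⟩
    (x * z) * (g * y) ≈⟨ *-cong (recips-inverse 1≤w j)
                           (geo-inverse (ℕₚ.≤-trans 1≤w (ℕₚ.m≤m+n w (w ℕ.* j)))) ⟩
    1# * 1#           ≈⟨ *-identityˡ 1# ⟩
    1#                ∎
    where
    x = prod Sign.- w w j
    y = 1# - q (w ℕ.+ w ℕ.* j)
    z = recips w (+ j)
    g = geo (w ℕ.+ w ℕ.* j)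

  recips-pred : ∀ {w} → 1 ℕ.≤ w → ∀ {m} → 0ℤ ℤ.≤ m →
                recips w (m ℤ.- 1ℤ) ≈ recips w m * (1# - mono (+ w ℤ.* m))
  recips-pred {w} 1≤w {+ zero} _ = sym (begin
    1# * (1# - mono (+ w ℤ.* 0ℤ)) ≈⟨ *-congˡ (+-congˡ (-‿cong (reflexive (≡.cong mono (ℤₚ.*-zeroʳ (+ w)))))) ⟩
    1# * (1# - q 0)               ≈⟨ *-congˡ (+-congˡ (-‿cong q-0)) ⟩
    1# * (1# - 1#)                ≈⟨ *-congˡ (-‿inverseʳ 1#) ⟩
    1# * 0#                       ≈⟨ zeroʳ 1# ⟩
    0#                            ∎)
  recips-pred {w} 1≤w {+ suc j} _ = sym (begin
    recips w (+ j) * geo e * (1# - mono (+ w ℤ.* + suc j)) ≈⟨ *-assoc _ _ _ ⟩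
    recips w (+ j) * (geo e * (1# - mono (+ w ℤ.* + suc j)))
      ≈⟨ *-congˡ (*-congˡ (+-congˡ (-‿cong (reflexive (≡.cong mono
           (≡.trans (≡.sym (ℤₚ.pos-* w (suc j))) (≡.cong +_ (ℕₚ.*-suc w j)))))))) ⟩
    recips w (+ j) * (geo e * (1# - q e))
      ≈⟨ *-congˡ (geo-inverse (ℕₚ.≤-trans 1≤w (ℕₚ.m≤m+n w (w ℕ.* j)))) ⟩
    recips w (+ j) * 1#           ≈⟨ *-identityʳ _ ⟩
    recips w (+ j)                ∎)
    where e = w ℕ.+ w ℕ.* j

  recips-stable : ∀ {w} → 1 ℕ.≤ w → ∀ {m} → + suc N ℤ.≤ m → prod∞ Sign.- w w * recips w m ≈ 1#
  recips-stable {w} 1≤w {+ j} (+≤+ N<j) =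
    trans (*-congʳ (sym (prod-stable Sign.- w 1≤w N<j))) (recips-inverse 1≤w j)

  -- The Jacobi triple product through its finite form.

  module TripleProduct (s : Sign) (a b h : ℕ) (a+b≡h+h : a ℕ.+ b ≡ h ℕ.+ h) (1≤h : 1 ℕ.≤ h)
                       (adm : Admissible (+ h) (+ a ℤ.- + h) 0ℤ) where

    w : ℕ
    w = a ℕ.+ b

    exponent : ℤ → ℤ
    exponent = quad (+ h) (+ a ℤ.- + h) 0ℤ

    coefficient : ℤ → Carrier
    coefficient n = term (s ^ˢ n) (exponent n)

    private
      1≤w : 1 ℕ.≤ w
      1≤w = ≡.subst (1 ℕ.≤_) (≡.sym a+b≡h+h) (ℕₚ.≤-trans 1≤h (ℕₚ.m≤m+n h h))

      +w : + w ≡ + h ℤ.+ + h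
      +w = ≡.cong +_ a+b≡h+h

      +w* : ∀ j → + (w ℕ.* j) ≡ (+ h ℤ.+ + h) ℤ.* + j
      +w* j = ≡.trans (ℤₚ.pos-* w j) (≡.cong (ℤ._* + j) +w)

      +b : + b ≡ + h ℤ.+ + h ℤ.- + a
      +b = ≡.trans (cancel (+ a) (+ b)) (≡.cong (ℤ._- + a) +w)
        where
        cancel : ∀ x y → y ≡ x ℤ.+ y ℤ.- x
        cancel = solve-∀

      X : ℕ → Carrier
      X = prod Sign.- w w

      r : ℤ → Carrier
      r = recips w

      -- Summand of the finite triple product: `coefficient n` times the Gaussian binomial of A + B
      -- over A - n in base q^w. It is 0 outside -B ≤ n ≤ A because `recips` is 0 at negative
      -- arguments.
      u : ℕ → ℕ → ℤ → Carrier
      u A B n = coefficient n * (X (A ℕ.+ B) * (r (+ A ℤ.- n) * r (+ B ℤ.+ n)))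

      0≤w* : ∀ {m} → 0ℤ ℤ.≤ m → 0ℤ ℤ.≤ + w ℤ.* m
      0≤w* = 0≤* {+ w} (+≤+ z≤n)

      -- The two q-Pascal rules in one: m and k are the two lower entries of a
      -- q-binomial coefficient, and negative entries are absorbed by r.
      pascal : ∀ L m k {c c′ z} → + suc L ≡ m ℤ.+ k → (0ℤ ℤ.≤ m → z * c′ ≈ mono (+ w ℤ.* m) * c) →
               c * (X L * (r (m ℤ.- 1ℤ) * r k)) + z * (c′ * (X L * (r m * r (k ℤ.- 1ℤ))))
               ≈ c * (X (suc L) * (r m * r k))
      pascal L -[1+ m ] k {c} {c′} {z} _ _ =
        solve 7 (λ c x y z c′ v x′ → c :* (x :* (con 0 :* y)) :+ z :* (c′ :* (x :* (con 0 :* v)))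
                                    := c :* (x′ :* (con 0 :* y))) refl
          c (X L) (r k) z c′ (r (k ℤ.- 1ℤ)) (X (suc L))
      pascal L (+ m) -[1+ k ] {c} {c′} {z} _ _ =
        solve 7 (λ c x y z c′ v x′ → c :* (x :* (y :* con 0)) :+ z :* (c′ :* (x :* (v :* con 0)))
                                    := c :* (x′ :* (v :* con 0))) refl
          c (X L) (r (+ m ℤ.- 1ℤ)) z c′ (r (+ m)) (X (suc L))
      pascal L m@(+ _) k@(+ _) {c} {c′} {z} L+1≡m+k zc′≈ = begin
        c * (X L * (r (m ℤ.- 1ℤ) * r k)) + z * (c′ * (X L * (r m * r (k ℤ.- 1ℤ))))
          -- `recips-pred` turns both terms into multiples of r m · r k, with factors 1 - x and x (1
          -- - y). Their sum telescopes to 1 - xy, the factor that leads from X L to X (suc L).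
          ≈⟨ +-cong (*-congˡ (*-congˡ (*-congʳ (recips-pred 1≤w 0≤m))))
                    (trans (sym (*-assoc z c′ _))
                           (*-cong (zc′≈ 0≤m) (*-congˡ (*-congˡ (recips-pred 1≤w 0≤k))))) ⟩
        c * (X L * (r m * (1# - x) * r k)) + (x * c) * (X L * (r m * (r k * (1# - y))))
          ≈⟨ solve 7 (λ c X rm rk x v v′ →
               c :* (X :* (rm :* v :* rk)) :+ (x :* c) :* (X :* (rm :* (rk :* v′)))
               := c :* (X :* (v :+ x :* v′) :* (rm :* rk)))
               refl c (X L) (r m) (r k) x (1# - x) (1# - y) ⟩
        c * (X L * ((1# - x) + x * (1# - y)) * (r m * r k))
          ≈⟨ *-congˡ (*-congʳ (*-congˡ telescope)) ⟩
        c * (X L * (1# - q (w ℕ.+ w ℕ.* L)) * (r m * r k)) ∎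
        where
        0≤m : 0ℤ ℤ.≤ m
        0≤m = +≤+ z≤n
        0≤k : 0ℤ ℤ.≤ k
        0≤k = +≤+ z≤n
        x = mono (+ w ℤ.* m)
        y = mono (+ w ℤ.* k)
        xy : x * y ≈ q (w ℕ.+ w ℕ.* L)
        xy = begin
          x * y                        ≈⟨ mono-+ (0≤w* 0≤m) (0≤w* 0≤k) ⟨
          mono (+ w ℤ.* m ℤ.+ + w ℤ.* k) ≡⟨ ≡.cong mono (≡.sym (ℤₚ.*-distribˡ-+ (+ w) m k)) ⟩
          mono (+ w ℤ.* (m ℤ.+ k))     ≡⟨ ≡.cong (λ i → mono (+ w ℤ.* i)) L+1≡m+k ⟨
          mono (+ w ℤ.* + suc L)       ≡⟨ ≡.cong mono (≡.sym (ℤₚ.pos-* w (suc L))) ⟩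
          q (w ℕ.* suc L)              ≡⟨ ≡.cong q (ℕₚ.*-suc w L) ⟩
          q (w ℕ.+ w ℕ.* L)            ∎
        telescope : (1# - x) + x * (1# - y) ≈ 1# - q (w ℕ.+ w ℕ.* L)
        telescope = begin
          (1# - x) + x * (1# - y)
            ≈⟨ solve 4 (λ o -x x -y → (o :+ -x) :+ x :* (o :+ -y) := o :+ (x :* o :+ -x) :+ x :* -y)
                 refl 1# (- x) x (- y) ⟩
          1# + (x * 1# - x) + x * - y
            ≈⟨ +-cong (+-congˡ (trans (+-congʳ (*-identityʳ x)) (-‿inverseʳ x))) (sym (-‿distribʳ-* x y)) ⟩
          1# + 0# - x * y
            ≈⟨ +-cong (+-identityʳ 1#) (-‿cong xy) ⟩
          1# - q (w ℕ.+ w ℕ.* L) ∎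

      coefficient-step : ∀ d n m {n′} → 0ℤ ℤ.≤ m → s Sign.* s ^ˢ n′ ≡ s ^ˢ n →
                         + d ℤ.+ exponent n′ ≡ + w ℤ.* m ℤ.+ exponent n →
                         (s ◃ q d) * coefficient n′ ≈ mono (+ w ℤ.* m) * coefficient n
      coefficient-step d n m {n′} 0≤m signs exponents = begin
        term s (+ d) * coefficient n′           ≈⟨ term-* s (s ^ˢ n′) (+≤+ z≤n) (0≤quad adm n′) ⟩
        term (s Sign.* s ^ˢ n′) (+ d ℤ.+ exponent n′) ≈⟨ term-≡ signs exponents ⟩
        term (s ^ˢ n) (+ w ℤ.* m ℤ.+ exponent n) ≈⟨ term-* Sign.+ (s ^ˢ n) (0≤w* 0≤m) (0≤quad adm n) ⟨
        mono (+ w ℤ.* m) * coefficient n        ∎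

      u-cong : ∀ A B n {i j} → i ≡ + A ℤ.- n → j ≡ + B ℤ.+ n →
               coefficient n * (X (A ℕ.+ B) * (r i * r j)) ≈ u A B n
      u-cong A B n ≡.refl ≡.refl = refl

      -- Multiplication by the next factor 1 + s q^(a+wA) adds a shifted copy of the family. The
      -- quadratic exponent is such that the shift costs exactly q^(w(A+1-n)), the weight in the
      -- q-Pascal rule.
      u-sucA : ∀ A B n → u A B n + (s ◃ q (a ℕ.+ w ℕ.* A)) * u A B (n ℤ.+ -1ℤ) ≈ u (suc A) B n
      u-sucA A B n = begin
        u A B n + z * u A B (n ℤ.+ -1ℤ)
          ≈⟨ +-cong (u-cong A B n (e₁ (+ A) n) ≡.refl)
                    (*-congˡ (u-cong A B (n ℤ.+ -1ℤ) (e₂ (+ A) n) (e₃ (+ B) n))) ⟨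
        coefficient n * (X (A ℕ.+ B) * (r (m ℤ.- 1ℤ) * r k))
          + z * (coefficient (n ℤ.+ -1ℤ) * (X (A ℕ.+ B) * (r m * r (k ℤ.- 1ℤ))))
          ≈⟨ pascal (A ℕ.+ B) m k (e₄ (+ A) (+ B) n)
               (λ 0≤m → coefficient-step (a ℕ.+ w ℕ.* A) n m 0≤m signs exponents) ⟩
        u (suc A) B n ∎
        where
        z = s ◃ q (a ℕ.+ w ℕ.* A)
        m = + suc A ℤ.- n
        k = + B ℤ.+ n
        e₁ : ∀ A n → 1ℤ ℤ.+ A ℤ.- n ℤ.- 1ℤ ≡ A ℤ.- n
        e₁ = solve-∀
        e₂ : ∀ A n → 1ℤ ℤ.+ A ℤ.- n ≡ A ℤ.- (n ℤ.+ -1ℤ)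
        e₂ = solve-∀
        e₃ : ∀ B n → B ℤ.+ n ℤ.- 1ℤ ≡ B ℤ.+ (n ℤ.+ -1ℤ)
        e₃ = solve-∀
        e₄ : ∀ A B n → 1ℤ ℤ.+ (A ℤ.+ B) ≡ 1ℤ ℤ.+ A ℤ.- n ℤ.+ (B ℤ.+ n)
        e₄ = solve-∀
        signs : s Sign.* s ^ˢ (n ℤ.+ -1ℤ) ≡ s ^ˢ n
        signs = ≡.trans (≡.sym (^ˢ-suc s (n ℤ.+ -1ℤ))) (≡.cong (s ^ˢ_) (cancel n))
          where
          cancel : ∀ n → n ℤ.+ -1ℤ ℤ.+ 1ℤ ≡ n
          cancel = solve-∀
        expand : ∀ a h A n → a ℤ.+ (h ℤ.+ h) ℤ.* A ℤ.+ (h ℤ.* ((n ℤ.+ -1ℤ) ℤ.* (n ℤ.+ -1ℤ)) ℤ.+ (a ℤ.- h) ℤ.* (n ℤ.+ -1ℤ) ℤ.+ 0ℤ)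
               ≡ (h ℤ.+ h) ℤ.* (1ℤ ℤ.+ A ℤ.- n) ℤ.+ (h ℤ.* (n ℤ.* n) ℤ.+ (a ℤ.- h) ℤ.* n ℤ.+ 0ℤ)
        expand = solve-∀
        exponents : + (a ℕ.+ w ℕ.* A) ℤ.+ exponent (n ℤ.+ -1ℤ) ≡ + w ℤ.* m ℤ.+ exponent n
        exponents = ≡.trans (≡.cong (λ i → + a ℤ.+ i ℤ.+ exponent (n ℤ.+ -1ℤ)) (+w* A))
          (≡.trans (expand (+ a) (+ h) (+ A) n) (≡.cong (λ v → v ℤ.* m ℤ.+ exponent n) (≡.sym +w)))

      u-sucB : ∀ A B n → u A B n + (s ◃ q (b ℕ.+ w ℕ.* B)) * u A B (n ℤ.+ 1ℤ) ≈ u A (suc B) n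
      u-sucB A B n = begin
        u A B n + z * u A B (n ℤ.+ 1ℤ)
          -- This is the other Pascal rule: the two lower entries exchange their roles, hence the
          -- commutation of the reciprocals.
          ≈⟨ +-cong (trans (*-congˡ (*-congˡ (*-comm _ _))) (u-cong A B n ≡.refl (e₁ (+ B) n)))
                    (*-congˡ (trans (*-congˡ (*-congˡ (*-comm _ _)))
                                    (u-cong A B (n ℤ.+ 1ℤ) (e₂ (+ A) n) (e₃ (+ B) n)))) ⟨
        coefficient n * (X (A ℕ.+ B) * (r (m ℤ.- 1ℤ) * r k))
          + z * (coefficient (n ℤ.+ 1ℤ) * (X (A ℕ.+ B) * (r m * r (k ℤ.- 1ℤ))))
          ≈⟨ pascal (A ℕ.+ B) m k (e₄ (+ A) (+ B) n)
               (λ 0≤m → coefficient-step (b ℕ.+ w ℕ.* B) n m 0≤m signs exponents) ⟩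
        coefficient n * (X (suc (A ℕ.+ B)) * (r m * r k))
          ≈⟨ *-congˡ (*-cong (reflexive (≡.cong X (≡.sym (ℕₚ.+-suc A B)))) (*-comm _ _)) ⟩
        u A (suc B) n ∎
        where
        z = s ◃ q (b ℕ.+ w ℕ.* B)
        m = + suc B ℤ.+ n
        k = + A ℤ.- n
        e₁ : ∀ B n → 1ℤ ℤ.+ B ℤ.+ n ℤ.- 1ℤ ≡ B ℤ.+ n
        e₁ = solve-∀
        e₂ : ∀ A n → A ℤ.- n ℤ.- 1ℤ ≡ A ℤ.- (n ℤ.+ 1ℤ)
        e₂ = solve-∀
        e₃ : ∀ B n → 1ℤ ℤ.+ B ℤ.+ n ≡ B ℤ.+ (n ℤ.+ 1ℤ)
        e₃ = solve-∀
        e₄ : ∀ A B n → 1ℤ ℤ.+ (A ℤ.+ B) ≡ 1ℤ ℤ.+ B ℤ.+ n ℤ.+ (A ℤ.- n)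
        e₄ = solve-∀
        signs : s Sign.* s ^ˢ (n ℤ.+ 1ℤ) ≡ s ^ˢ n
        signs = ≡.trans (≡.cong (s Sign.*_) (^ˢ-suc s n))
          (≡.trans (≡.sym (Signₚ.*-assoc s s (s ^ˢ n))) (≡.cong (Sign._* (s ^ˢ n)) (Signₚ.s*s≡+ s)))
        expand : ∀ a h B n → (h ℤ.+ h ℤ.- a) ℤ.+ (h ℤ.+ h) ℤ.* B ℤ.+ (h ℤ.* ((n ℤ.+ 1ℤ) ℤ.* (n ℤ.+ 1ℤ)) ℤ.+ (a ℤ.- h) ℤ.* (n ℤ.+ 1ℤ) ℤ.+ 0ℤ)
               ≡ (h ℤ.+ h) ℤ.* (1ℤ ℤ.+ B ℤ.+ n) ℤ.+ (h ℤ.* (n ℤ.* n) ℤ.+ (a ℤ.- h) ℤ.* n ℤ.+ 0ℤ)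
        expand = solve-∀
        exponents : + (b ℕ.+ w ℕ.* B) ℤ.+ exponent (n ℤ.+ 1ℤ) ≡ + w ℤ.* m ℤ.+ exponent n
        exponents = ≡.trans (≡.cong (ℤ._+ exponent (n ℤ.+ 1ℤ)) (≡.cong₂ ℤ._+_ +b (+w* B)))
          (≡.trans (expand (+ a) (+ h) (+ B) n) (≡.cong (λ v → v ℤ.* m ℤ.+ exponent n) (≡.sym +w)))

      u-hasSum₀ : HasSum (u 0 0) (1# * 1#)
      u-hasSum₀ = record
        { support = 0ℤ ∷ []
        ; unique  = [] ∷ []
        ; vanish  = λ {n} → vanishes n
        ; total   = begin
            coefficient 0ℤ * (1# * (1# * 1#)) + 0#
              ≈⟨ +-congʳ (*-congʳ (term-≡ (s⁰ s) (zeros (+ h) (+ a)))) ⟩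
            q 0 * (1# * (1# * 1#)) + 0#
              ≈⟨ +-congʳ (*-congʳ q-0) ⟩
            1# * (1# * (1# * 1#)) + 0#
              ≈⟨ solve 0 (con 1 :* (con 1 :* (con 1 :* con 1)) :+ con 0 := con 1 :* con 1) refl ⟩
            1# * 1# ∎ }
        where
        s⁰ : ∀ s → s ^ˢ 0ℤ ≡ Sign.+
        s⁰ Sign.+ = ≡.refl
        s⁰ Sign.- = ≡.refl
        zeros : ∀ h a → h ℤ.* (0ℤ ℤ.* 0ℤ) ℤ.+ (a ℤ.- h) ℤ.* 0ℤ ℤ.+ 0ℤ ≡ 0ℤ
        zeros = solve-∀
        vanishes : ∀ n → n ∉ 0ℤ ∷ [] → u 0 0 n ≈ 0#
        vanishes (+ zero)  n∉ = contradiction (here ≡.refl) n∉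
        vanishes (+ suc n) _  = solve 2 (λ c y → c :* (con 1 :* (con 0 :* y)) := con 0) refl
                                  (coefficient (+ suc n)) (r (+ suc n))
        vanishes -[1+ n ]  _  = solve 2 (λ c y → c :* (con 1 :* (y :* con 0)) := con 0) refl
                                  (coefficient -[1+ n ]) (r (+ suc n))

      -- Induction on the number of factors, from the empty products, whose family lives at n = 0
      -- only.
      u-hasSum : ∀ A B → HasSum (u A B) (prod s a w A * prod s b w B)
      u-hasSum zero    zero    = u-hasSum₀
      u-hasSum zero    (suc B) = hasSum-cong (u-sucB 0 B)
        (solve 3 (λ p p′ z → p :* p′ :+ z :* (p :* p′) := p :* (p′ :* (con 1 :+ z))) refl _ _ _)
        (hasSum-+ ℤₚ._≟_ (u-hasSum 0 B) (hasSum-*ˡ _ (hasSum-shift 1ℤ (u-hasSum 0 B))))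
      u-hasSum (suc A) B       = hasSum-cong (u-sucA A B)
        (solve 3 (λ p p′ z → p :* p′ :+ z :* (p :* p′) := p :* (con 1 :+ z) :* p′) refl _ _ _)
        (hasSum-+ ℤₚ._≟_ (u-hasSum A B) (hasSum-*ˡ _ (hasSum-shift -1ℤ (u-hasSum A B))))

      M : ℕ
      M = suc N ℕ.+ suc N

      X∞ : Carrier
      X∞ = prod∞ Sign.- w w

      -- For |n| ≤ N + 1 both M - n and M + n are at least N + 1, which is why M = 2(N + 1): all
      -- symbols have stabilised there and the binomial is the inverse of `X∞`. For larger |n| both
      -- sides are 0.
      u-limit : ∀ n → X∞ * u M M n ≈ coefficient n
      u-limit n with ∣ n ∣ ℕ.≤? suc N
      ... | no  ∣n∣≰ = begin
        X∞ * u M M n    ≈⟨ *-congˡ (*-congʳ c≈0) ⟩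
        X∞ * (0# * _)   ≈⟨ *-congˡ (zeroˡ _) ⟩
        X∞ * 0#         ≈⟨ zeroʳ _ ⟩
        0#              ≈⟨ c≈0 ⟨
        coefficient n   ∎
        where c≈0 = quad-vanish adm (s ^ˢ n) n (ℕₚ.≰⇒> ∣n∣≰)
      ... | yes ∣n∣≤ = begin
        X∞ * (c * (X (M ℕ.+ M) * (r i * r j)))
          ≈⟨ *-congˡ (*-congˡ (*-congʳ (prod-stable Sign.- w 1≤w
               (ℕₚ.≤-trans (ℕₚ.m≤m+n (suc N) (suc N)) (ℕₚ.m≤m+n M M))))) ⟩
        X∞ * (c * (X∞ * (r i * r j)))
          ≈⟨ solve 4 (λ x c ri rj → x :* (c :* (x :* (ri :* rj))) := c :* ((x :* ri) :* (x :* rj)))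
               refl X∞ c (r i) (r j) ⟩
        c * ((X∞ * r i) * (X∞ * r j))
          ≈⟨ *-congˡ (*-cong (recips-stable 1≤w (bound (ℤ.- n) (ℕₚ.≤-trans (ℕₚ.≤-reflexive (ℤₚ.∣-i∣≡∣i∣ n)) ∣n∣≤)))
                             (recips-stable 1≤w (bound n ∣n∣≤))) ⟩
        c * (1# * 1#) ≈⟨ *-congˡ (*-identityˡ 1#) ⟩
        c * 1#        ≈⟨ *-identityʳ c ⟩
        c             ∎
        where
        c = coefficient n
        i = + M ℤ.- n
        j = + M ℤ.+ n
        -∣n∣≤n : ∀ n → ℤ.- + ∣ n ∣ ℤ.≤ n
        -∣n∣≤n (+ zero)  = +≤+ z≤n
        -∣n∣≤n (+ suc _) = ℤ.-≤+
        -∣n∣≤n -[1+ _ ]  = ℤₚ.≤-refl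
        bound : ∀ n → ∣ n ∣ ℕ.≤ suc N → + suc N ℤ.≤ + M ℤ.+ n
        bound n ∣n∣≤ = ≡.subst (ℤ._≤ + M ℤ.+ n) (cancel (+ suc N))
          (ℤₚ.+-monoʳ-≤ (+ M) (ℤₚ.≤-trans (ℤₚ.neg-mono-≤ (+≤+ ∣n∣≤)) (-∣n∣≤n n)))
          where
          cancel : ∀ x → x ℤ.+ x ℤ.+ ℤ.- x ≡ x
          cancel = solve-∀

    tripleProduct : HasSum coefficient (prod∞ s a w * prod∞ s b w * prod∞ Sign.- w w)
    tripleProduct = hasSum-cong u-limit
      (trans (*-comm _ _) (*-congʳ (*-cong (prod-stable s a 1≤w N<M) (prod-stable s b 1≤w N<M))))
      (hasSum-*ˡ X∞ (u-hasSum M M))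
      where
      N<M : suc N ℕ.≤ M
      N<M = ℕₚ.m≤m+n (suc N) (suc N)

-- The partition of ℤ² into three cosets, and a sign rule.

_≟²_ : DecidableEquality (ℤ × ℤ)
_≟²_ = ≡-dec ℤₚ._≟_ ℤₚ._≟_

Residue : Set
Residue = (ℤ × ℤ) ⊎ (ℤ × ℤ) ⊎ (ℤ × ℤ)

data Mod3 : ℤ → Set where
  3i+0 : ∀ i → Mod3 (+ 3 ℤ.* i ℤ.+ 0ℤ)
  3i+1 : ∀ i → Mod3 (+ 3 ℤ.* i ℤ.+ 1ℤ)
  3i+2 : ∀ i → Mod3 (+ 3 ℤ.* i ℤ.+ + 2)

mod3 : ∀ t → Mod3 t
mod3 t = go (t ℤ./ℕ 3) (t ℤ.%ℕ 3) (ℤDivMod.n%ℕd<d t 3)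
            (≡.trans (ℤDivMod.a≡a%ℕn+[a/ℕn]*n t 3) (rearrange (+ (t ℤ.%ℕ 3)) (t ℤ./ℕ 3)))
  where
  rearrange : ∀ r i → r ℤ.+ i ℤ.* + 3 ≡ + 3 ℤ.* i ℤ.+ r
  rearrange = solve-∀
  go : ∀ i r → r ℕ.< 3 → t ≡ + 3 ℤ.* i ℤ.+ + r → Mod3 t
  go i 0 _ eq = ≡.subst Mod3 (≡.sym eq) (3i+0 i)
  go i 1 _ eq = ≡.subst Mod3 (≡.sym eq) (3i+1 i)
  go i 2 _ eq = ≡.subst Mod3 (≡.sym eq) (3i+2 i)
  go i (suc (suc (suc _))) (s≤s (s≤s (s≤s ()))) _

3i≢ : ∀ {r} → ¬ (3 ∣ r) → ∀ i → + 3 ℤ.* i ≢ + r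
3i≢ 3∤r i eq = 3∤r (divides ∣ i ∣
  (≡.trans (≡.cong ∣_∣ (≡.sym eq)) (≡.trans (ℤₚ.abs-* (+ 3) i) (ℕₚ.*-comm 3 ∣ i ∣))))

residues-differ : ∀ {r} → ¬ (3 ∣ r) → ∀ ρ {i j} → + 3 ℤ.* i ℤ.+ (ρ ℤ.+ + r) ≢ + 3 ℤ.* j ℤ.+ ρ
residues-differ {r} 3∤r ρ {i} {j} eq = 3i≢ 3∤r (j ℤ.- i) (begin
  + 3 ℤ.* (j ℤ.- i)                                               ≡⟨ rearrange i j ρ ⟩
  + 3 ℤ.* j ℤ.+ ρ ℤ.- (+ 3 ℤ.* i ℤ.+ ρ)                           ≡⟨ ≡.cong (ℤ._- (+ 3 ℤ.* i ℤ.+ ρ)) eq ⟨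
  + 3 ℤ.* i ℤ.+ (ρ ℤ.+ + r) ℤ.- (+ 3 ℤ.* i ℤ.+ ρ)                 ≡⟨ cancel i ρ (+ r) ⟩
  + r                                                             ∎)
  where
  open ≡.≡-Reasoning
  rearrange : ∀ i j ρ → + 3 ℤ.* (j ℤ.- i) ≡ + 3 ℤ.* j ℤ.+ ρ ℤ.- (+ 3 ℤ.* i ℤ.+ ρ)
  rearrange = solve-∀
  cancel : ∀ i ρ r → + 3 ℤ.* i ℤ.+ (ρ ℤ.+ r) ℤ.- (+ 3 ℤ.* i ℤ.+ ρ) ≡ r
  cancel = solve-∀

module Sublattices (c d₀ d₁ d₂ : ℤ) where

  -- The slope `c` is chosen later so that a given quadratic form becomes diagonal in (i, l); the
  -- offset `d` adjusts the linear terms of the two resulting exponents.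
  embed : ℤ → ℤ → ℤ × ℤ → ℤ × ℤ
  embed ρ d (i , l) = + 3 ℤ.* i ℤ.+ ρ , c ℤ.* i ℤ.+ l ℤ.+ d

  join : Residue → ℤ × ℤ
  join = [ embed 0ℤ d₀ , [ embed 1ℤ d₁ , embed (+ 2) d₂ ] ]

  embed-injective : ∀ ρ d {x y} → embed ρ d x ≡ embed ρ d y → x ≡ y
  embed-injective ρ d {i , l} {j , m} eq = ≡.cong₂ _,_ i≡j l≡m
    where
    cancelˡ : ∀ {k i j} → i ℤ.+ k ≡ j ℤ.+ k → i ≡ j
    cancelˡ {k} {i} {j} e = ≡.trans (≡.sym (x+y-y i k)) (≡.trans (≡.cong (ℤ._- k) e) (x+y-y j k))
      where
      x+y-y : ∀ x y → x ℤ.+ y ℤ.- y ≡ x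
      x+y-y = solve-∀
    i≡j : i ≡ j
    i≡j = ℤₚ.*-cancelˡ-≡ (+ 3) i j (cancelˡ (≡.cong proj₁ eq))
    l≡m : l ≡ m
    l≡m = cancelˡ {c ℤ.* j} (≡.trans (ℤₚ.+-comm l _) (≡.trans
      (≡.trans (≡.cong (λ k → c ℤ.* k ℤ.+ l) (≡.sym i≡j)) (cancelˡ (≡.cong proj₂ eq)))
      (ℤₚ.+-comm _ m)))

  join-injective : ∀ {x y} → join x ≡ join y → x ≡ y
  join-injective {inj₁ _} {inj₁ _} eq = ≡.cong inj₁ (embed-injective 0ℤ d₀ eq)
  join-injective {inj₂ (inj₁ _)} {inj₂ (inj₁ _)} eq = ≡.cong (inj₂ ∘ inj₁) (embed-injective 1ℤ d₁ eq)
  join-injective {inj₂ (inj₂ _)} {inj₂ (inj₂ _)} eq = ≡.cong (inj₂ ∘ inj₂) (embed-injective (+ 2) d₂ eq)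
  join-injective {inj₁ (i , _)} {inj₂ (inj₁ (j , _))} eq =
    contradiction (≡.sym (≡.cong proj₁ eq)) (residues-differ (from-no (3 ∣? 1)) 0ℤ {j} {i})
  join-injective {inj₁ (i , _)} {inj₂ (inj₂ (j , _))} eq =
    contradiction (≡.sym (≡.cong proj₁ eq)) (residues-differ (from-no (3 ∣? 2)) 0ℤ {j} {i})
  join-injective {inj₂ (inj₁ (i , _))} {inj₁ (j , _)} eq =
    contradiction (≡.cong proj₁ eq) (residues-differ (from-no (3 ∣? 1)) 0ℤ {i} {j})
  join-injective {inj₂ (inj₁ (i , _))} {inj₂ (inj₂ (j , _))} eq =
    contradiction (≡.sym (≡.cong proj₁ eq)) (residues-differ (from-no (3 ∣? 1)) 1ℤ {j} {i})
  join-injective {inj₂ (inj₂ (i , _))} {inj₁ (j , _)} eq =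
    contradiction (≡.cong proj₁ eq) (residues-differ (from-no (3 ∣? 2)) 0ℤ {i} {j})
  join-injective {inj₂ (inj₂ (i , _))} {inj₂ (inj₁ (j , _))} eq =
    contradiction (≡.cong proj₁ eq) (residues-differ (from-no (3 ∣? 1)) 1ℤ {i} {j})

  cancel-offsets : ∀ x b d → x ℤ.+ (b ℤ.- x ℤ.- d) ℤ.+ d ≡ b
  cancel-offsets = solve-∀

  join-surjective : ∀ y → ∃ λ x → join x ≡ y
  join-surjective (t , b) with mod3 t
  ... | 3i+0 i = inj₁ (i , b ℤ.- c ℤ.* i ℤ.- d₀)        , ≡.cong (_ ,_) (cancel-offsets (c ℤ.* i) b d₀)
  ... | 3i+1 i = inj₂ (inj₁ (i , b ℤ.- c ℤ.* i ℤ.- d₁)) , ≡.cong (_ ,_) (cancel-offsets (c ℤ.* i) b d₁)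
  ... | 3i+2 i = inj₂ (inj₂ (i , b ℤ.- c ℤ.* i ℤ.- d₂)) , ≡.cong (_ ,_) (cancel-offsets (c ℤ.* i) b d₂)

^ˢ-opposite : ∀ s t → s ^ˢ t Sign.* parity t ≡ opposite s ^ˢ t
^ˢ-opposite Sign.+ t = ≡.refl
^ˢ-opposite Sign.- t = Signₚ.s*s≡+ (parity t)

-- s^i depends on i modulo 2 only, so the term 2j drops out; and s^t (-1)^t = (-s)^t.
shear-sign : ∀ s ρ {i y} t j → i ≡ t ℤ.+ ρ ℤ.- (j ℤ.+ j) → y ≡ t ℤ.+ j →
             s ^ˢ ρ Sign.* opposite s ^ˢ t Sign.* parity j ≡ s ^ˢ i Sign.* parity y
shear-sign s ρ {i} t j eq ≡.refl = ≡.sym (begin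
  s ^ˢ i Sign.* parity (t ℤ.+ j)
    ≡⟨ ≡.cong₂ Sign._*_ (^ˢ-congruent s (ρ ℤ.+ t) (ℤ.- j) (≡.trans eq (rearrange t ρ j))) (parity-+ t j) ⟩
  s ^ˢ (ρ ℤ.+ t) Sign.* (parity t Sign.* parity j)
    ≡⟨ ≡.cong (Sign._* _) (^ˢ-+ s ρ t) ⟩
  s ^ˢ ρ Sign.* s ^ˢ t Sign.* (parity t Sign.* parity j)
    ≡⟨ Signₚ.*-assoc (s ^ˢ ρ Sign.* s ^ˢ t) (parity t) (parity j) ⟨
  s ^ˢ ρ Sign.* s ^ˢ t Sign.* parity t Sign.* parity j
    ≡⟨ ≡.cong (Sign._* parity j) (Signₚ.*-assoc (s ^ˢ ρ) (s ^ˢ t) (parity t)) ⟩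
  s ^ˢ ρ Sign.* (s ^ˢ t Sign.* parity t) Sign.* parity j
    ≡⟨ ≡.cong (λ u → s ^ˢ ρ Sign.* u Sign.* parity j) (^ˢ-opposite s t) ⟩
  s ^ˢ ρ Sign.* opposite s ^ˢ t Sign.* parity j ∎)
  where
  open ≡.≡-Reasoning
  rearrange : ∀ t ρ j → t ℤ.+ ρ ℤ.- (j ℤ.+ j) ≡ ρ ℤ.+ t ℤ.+ (ℤ.- j ℤ.+ ℤ.- j)
  rearrange = solve-∀

-- Products of theta series and dissections of infinite products.

module Products (T : TruncatedPowers) where

  open TruncatedPowers T
  open CommutativeRing commutativeRing
  open Summation commutativeRing
  open Theta T
  open Solver using (solve; _:=_; _:+_; _:*_; con)
  open import Algebra.Properties.Ring ring using (-‿distribʳ-*)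
  open import Relation.Binary.Reasoning.Setoid setoid

  hasSum-sublattices : ∀ c d₀ d₁ d₂ {f : ℤ × ℤ → Carrier} {s₀ s₁ s₂} → let open Sublattices c d₀ d₁ d₂ in
                       HasSum (f ∘ embed 0ℤ d₀) s₀ → HasSum (f ∘ embed 1ℤ d₁) s₁ →
                       HasSum (f ∘ embed (+ 2) d₂) s₂ → HasSum f (s₀ + (s₁ + s₂))
  hasSum-sublattices c d₀ d₁ d₂ H₀ H₁ H₂ =
    hasSum-bij join join-injective join-surjective (hasSum-⊎ H₀ (hasSum-⊎ H₁ H₂))
    where open Sublattices c d₀ d₁ d₂

  hasSum-swap : ∀ {f : ℤ × ℤ → Carrier} {s} → HasSum (f ∘ swap) s → HasSum f s
  hasSum-swap = hasSum-bij swap (λ { ≡.refl → ≡.refl }) (λ y → swap y , ≡.refl)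

  hasSum-separable : ∀ (σ τ : ℤ → Sign) {A B C A′ B′ C′ s t} {sign : ℤ × ℤ → Sign} {exponent : ℤ × ℤ → ℤ} →
    Admissible A B C → Admissible A′ B′ C′ →
    HasSum (λ i → term (σ i) (quad A B C i)) s → HasSum (λ l → term (τ l) (quad A′ B′ C′ l)) t →
    (∀ i l → σ i Sign.* τ l ≡ sign (i , l)) →
    (∀ i l → quad A B C i ℤ.+ quad A′ B′ C′ l ≡ exponent (i , l)) →
    HasSum (λ x → term (sign x) (exponent x)) (s * t)
  hasSum-separable σ τ adm adm′ H K signs exponents = hasSum-cong
    (λ (i , l) → trans (term-* (σ i) (τ l) (0≤quad adm i) (0≤quad adm′ l)) (term-≡ (signs i l) (exponents i l)))
    refl (hasSum-* ℤₚ._≟_ H K)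


  product : ℕ → (ℕ → Carrier) → Carrier
  product zero    f = 1#
  product (suc m) f = product m f * f m

  product-cong : ∀ m {f g : ℕ → Carrier} → (∀ c → f c ≈ g c) → product m f ≈ product m g
  product-cong zero    f≈g = refl
  product-cong (suc m) f≈g = *-cong (product-cong m f≈g) (f≈g m)

  product-1 : ∀ m → product m (λ _ → 1#) ≈ 1#
  product-1 zero    = refl
  product-1 (suc m) = trans (*-identityʳ _) (product-1 m)

  product-* : ∀ m (f g : ℕ → Carrier) → product m (λ c → f c * g c) ≈ product m f * product m g
  product-* zero    f g = sym (*-identityˡ 1#)
  product-* (suc m) f g = trans (*-congʳ (product-* m f g))
    (solve 4 (λ x y z w → x :* y :* (z :* w) := x :* z :* (y :* w)) refl _ _ (f m) (g m))

  prod-+ : ∀ s r k i j → prod s r k (i ℕ.+ j) ≈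
           prod s r k j * product i (λ c → 1# + s ◃ q (r ℕ.+ k ℕ.* (c ℕ.+ j)))
  prod-+ s r k zero    j = sym (*-identityʳ _)
  prod-+ s r k (suc i) j = trans (*-congʳ (prod-+ s r k i j)) (*-assoc _ _ _)

  prod-split : ∀ s r k m j → prod s r k (j ℕ.* m) ≈ product m (λ c → prod s (r ℕ.+ k ℕ.* c) (k ℕ.* m) j)
  prod-split s r k m zero    = sym (product-1 m)
  prod-split s r k m (suc j) = begin
    prod s r k (m ℕ.+ j ℕ.* m)
      ≈⟨ prod-+ s r k m (j ℕ.* m) ⟩
    prod s r k (j ℕ.* m) * product m (λ c → 1# + s ◃ q (r ℕ.+ k ℕ.* (c ℕ.+ j ℕ.* m)))
      ≈⟨ *-cong (prod-split s r k m j)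
           (product-cong m (λ c → +-congˡ (◃-cong s (reflexive (≡.cong q (rearrange c)))))) ⟩
    product m (λ c → prod s (r ℕ.+ k ℕ.* c) (k ℕ.* m) j)
      * product m (λ c → 1# + s ◃ q (r ℕ.+ k ℕ.* c ℕ.+ k ℕ.* m ℕ.* j))
      ≈⟨ product-* m _ _ ⟨
    product m (λ c → prod s (r ℕ.+ k ℕ.* c) (k ℕ.* m) (suc j)) ∎
    where
    rearrange : ∀ c → r ℕ.+ k ℕ.* (c ℕ.+ j ℕ.* m) ≡ r ℕ.+ k ℕ.* c ℕ.+ k ℕ.* m ℕ.* j
    rearrange c = identity r k c j m
      where
      identity : ∀ r k c j m → r ℕ.+ k ℕ.* (c ℕ.+ j ℕ.* m) ≡ r ℕ.+ k ℕ.* c ℕ.+ k ℕ.* m ℕ.* j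
      identity = ℕSolver.solve-∀

  -- Factors are sorted by index modulo m. The m products on the right have m(N + 1) factors
  -- together, so `prod-stable` first lengthens the left one.
  prod∞-split : ∀ s r k m → 1 ℕ.≤ k → 1 ℕ.≤ m →
                prod∞ s r k ≈ product m (λ c → prod∞ s (r ℕ.+ k ℕ.* c) (k ℕ.* m))
  prod∞-split s r k (suc m) 1≤k _ = trans
    (sym (prod-stable s r 1≤k (ℕₚ.m≤m*n (suc N) (suc m)))) (prod-split s r k (suc m) (suc N))

  prod-± : ∀ r k j → prod Sign.+ r k j * prod Sign.- r k j ≈ prod Sign.- (2 ℕ.* r) (2 ℕ.* k) j
  prod-± r k zero    = *-identityˡ 1#
  prod-± r k (suc j) = begin
    (x * (1# + e)) * (y * (1# - e))
      ≈⟨ solve 4 (λ x y z w → (x :* z) :* (y :* w) := (x :* y) :* (z :* w)) refl x y (1# + e) (1# - e) ⟩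
    (x * y) * ((1# + e) * (1# - e))
      ≈⟨ *-cong (prod-± r k j) (begin
           (1# + e) * (1# - e)
             ≈⟨ solve 2 (λ e -e → (con 1 :+ e) :* (con 1 :+ -e) := con 1 :+ (e :+ -e) :+ e :* -e)
                  refl e (- e) ⟩
           1# + (e - e) + e * - e
             ≈⟨ +-cong (trans (+-congˡ (-‿inverseʳ e)) (+-identityʳ 1#)) (sym (-‿distribʳ-* e e)) ⟩
           1# - e * e
             ≈⟨ +-congˡ (-‿cong (trans (sym (q-+ _ _)) (reflexive (≡.cong q (double r k j))))) ⟩
           1# - q (2 ℕ.* r ℕ.+ 2 ℕ.* k ℕ.* j) ∎) ⟩
    prod Sign.- (2 ℕ.* r) (2 ℕ.* k) (suc j) ∎
    where
    x = prod Sign.+ r k j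
    y = prod Sign.- r k j
    e = q (r ℕ.+ k ℕ.* j)
    double : ∀ r k j → r ℕ.+ k ℕ.* j ℕ.+ (r ℕ.+ k ℕ.* j) ≡ 2 ℕ.* r ℕ.+ 2 ℕ.* k ℕ.* j
    double = ℕSolver.solve-∀

  -- The quintuple product identity.

  module QuintupleProduct (s : Sign) (h a : ℤ)
    (adm₁ : Admissible h (a ℤ.- h) 0ℤ)
    (adm₂ : Admissible (h ℤ.+ h) (a ℤ.+ a) 0ℤ)
    (adm₃ : Admissible (+ 3 ℤ.* h) (+ 3 ℤ.* a ℤ.- h) 0ℤ)
    (adm₄ : Admissible (+ 3 ℤ.* h) (+ 3 ℤ.* a ℤ.+ h) a)
    (adm₅ : Admissible (+ 3 ℤ.* h) (+ 3 ℤ.* (a ℤ.+ h)) (+ 2 ℤ.* (a ℤ.+ h)))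
    (adm₆ : Admissible (+ 6 ℤ.* h) (+ 2 ℤ.* h) 0ℤ)
    (adm₇ : Admissible (+ 6 ℤ.* h) (ℤ.- (+ 2 ℤ.* h)) 0ℤ)
    (adm₈ : Admissible (+ 6 ℤ.* h) (ℤ.- (+ 6 ℤ.* h)) 0ℤ) where

    σ₀ σ₁ : ℤ → Sign
    σ₀ t = opposite s ^ˢ t
    σ₁ t = s Sign.* opposite s ^ˢ t

    private
      exponent₁ exponent₂ : ℤ → ℤ
      exponent₁ = quad h (a ℤ.- h) 0ℤ
      exponent₂ = quad (h ℤ.+ h) (a ℤ.+ a) 0ℤ

      sign : ℤ × ℤ → Sign
      sign (x , y) = s ^ˢ (x ℤ.- (y ℤ.+ y)) Sign.* parity y

      exponent : ℤ × ℤ → ℤ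
      exponent (x , y) = exponent₁ (x ℤ.- (y ℤ.+ y)) ℤ.+ exponent₂ y

      -- With x = i + 2j and y = j the form h i² + 2h j² becomes h(x² - 4xy + 6y²), and putting x =
      -- 3t + ρ, y = t + j′ turns it into 3h t² + 6h j′² up to lower terms.
      shear : ℤ × ℤ → ℤ × ℤ
      shear (i , j) = i ℤ.+ (j ℤ.+ j) , j

      unshear : ∀ i j → i ℤ.+ (j ℤ.+ j) ℤ.- (j ℤ.+ j) ≡ i
      unshear = solve-∀

      shear-injective : ∀ {x y} → shear x ≡ shear y → x ≡ y
      shear-injective {i , j} {k , l} eq = ≡.cong₂ _,_
        (≡.trans (≡.sym (unshear i j)) (≡.trans
          (≡.cong (λ (x , y) → x ℤ.- (y ℤ.+ y)) eq) (unshear k l)))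
        (≡.cong proj₂ eq)

      shear-surjective : ∀ y → ∃ λ x → shear x ≡ y
      shear-surjective (x , y) = (x ℤ.- (y ℤ.+ y) , y) , ≡.cong (_, y) (cancel x y)
        where
        cancel : ∀ x y → x ℤ.- (y ℤ.+ y) ℤ.+ (y ℤ.+ y) ≡ x
        cancel = solve-∀

      signs : ∀ ρ t j → s ^ˢ ρ Sign.* opposite s ^ˢ t Sign.* parity j
                      ≡ sign (Sublattices.embed 1ℤ 0ℤ 0ℤ 0ℤ ρ 0ℤ (t , j))
      signs ρ t j = shear-sign s ρ t j (e₁ ρ t j) (e₂ t j)
        where
        e₁ : ∀ ρ t j → + 3 ℤ.* t ℤ.+ ρ ℤ.- (1ℤ ℤ.* t ℤ.+ j ℤ.+ 0ℤ ℤ.+ (1ℤ ℤ.* t ℤ.+ j ℤ.+ 0ℤ)) ≡ t ℤ.+ ρ ℤ.- (j ℤ.+ j)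
        e₁ = solve-∀
        e₂ : ∀ t j → 1ℤ ℤ.* t ℤ.+ j ℤ.+ 0ℤ ≡ t ℤ.+ j
        e₂ = solve-∀

      s^0 : ∀ s → s ^ˢ 0ℤ ≡ Sign.+
      s^0 Sign.+ = ≡.refl
      s^0 Sign.- = ≡.refl

      s^1 : ∀ s → s ^ˢ 1ℤ ≡ s
      s^1 Sign.+ = ≡.refl
      s^1 Sign.- = ≡.refl

      s^2 : ∀ s → s ^ˢ + 2 ≡ Sign.+
      s^2 Sign.+ = ≡.refl
      s^2 Sign.- = ≡.refl

      signs′ : ∀ ρ s′ → s ^ˢ ρ ≡ s′ → ∀ t j → s′ Sign.* opposite s ^ˢ t Sign.* parity j
             ≡ sign (Sublattices.embed 1ℤ 0ℤ 0ℤ 0ℤ ρ 0ℤ (t , j))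
      signs′ ρ s′ ≡.refl = signs ρ

    module _ {j₁ j₂ eu : Carrier}
      (triple₁ : HasSum (λ i → term (s ^ˢ i) (exponent₁ i)) j₁)
      (triple₂ : HasSum (λ j → term (parity j) (exponent₂ j)) j₂)
      (euler   : HasSum (λ j → term (parity j) (quad (+ 6 ℤ.* h) (ℤ.- (+ 2 ℤ.* h)) 0ℤ j)) eu) where

      private
        whole : HasSum (λ x → term (sign x) (exponent x)) (j₁ * j₂)
        whole = hasSum-bij shear shear-injective shear-surjective (hasSum-cong
          (λ (i , j) → term-≡ (≡.cong (λ k → s ^ˢ k Sign.* parity j) (≡.sym (unshear i j)))
                              (≡.cong (λ k → exponent₁ k ℤ.+ exponent₂ j) (≡.sym (unshear i j))))
          refl (hasSum-separable (s ^ˢ_) parity adm₁ adm₂ triple₁ triple₂ (λ _ _ → ≡.refl) (λ _ _ → ≡.refl)))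

        reflected : HasSum (λ j → term (parity j) (quad (+ 6 ℤ.* h) (+ 2 ℤ.* h) 0ℤ j)) eu
        reflected = hasSum-cong (λ j → term-≡
          (parity-congruent j (ℤ.- j) (e₁ j)) (e₂ h j)) refl (hasSum-reflect 0ℤ euler)
          where
          e₁ : ∀ j → 0ℤ ℤ.- j ≡ j ℤ.+ (ℤ.- j ℤ.+ ℤ.- j)
          e₁ = solve-∀
          e₂ : ∀ h j → + 6 ℤ.* h ℤ.* ((0ℤ ℤ.- j) ℤ.* (0ℤ ℤ.- j)) ℤ.+ (ℤ.- (+ 2 ℤ.* h)) ℤ.* (0ℤ ℤ.- j) ℤ.+ 0ℤ
                     ≡ + 6 ℤ.* h ℤ.* (j ℤ.* j) ℤ.+ + 2 ℤ.* h ℤ.* j ℤ.+ 0ℤ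
          e₂ = solve-∀

        -- The exponent 6h j(j - 1) is invariant under j ↦ 1 - j while the sign (-1)^j changes. This
        -- removes the residue class 2.
        antisymmetric : theta parity (+ 6 ℤ.* h) (ℤ.- (+ 6 ℤ.* h)) 0ℤ ≈ 0#
        antisymmetric = antisymmetric⇒0 1ℤ (λ j → trans
          (term-≡ (≡.trans (parity-congruent (1ℤ ℤ.+ j) (ℤ.- j) (e₁ j)) (parity-suc j)) (e₂ h j))
          (◃-opposite (parity j) _)) (theta-hasSum parity adm₈)
          where
          e₁ : ∀ j → 1ℤ ℤ.- j ≡ 1ℤ ℤ.+ j ℤ.+ (ℤ.- j ℤ.+ ℤ.- j)
          e₁ = solve-∀
          e₂ : ∀ h j → + 6 ℤ.* h ℤ.* ((1ℤ ℤ.- j) ℤ.* (1ℤ ℤ.- j)) ℤ.+ (ℤ.- (+ 6 ℤ.* h)) ℤ.* (1ℤ ℤ.- j) ℤ.+ 0ℤ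
                     ≡ + 6 ℤ.* h ℤ.* (j ℤ.* j) ℤ.+ (ℤ.- (+ 6 ℤ.* h)) ℤ.* j ℤ.+ 0ℤ
          e₂ = solve-∀

        parts : HasSum (λ x → term (sign x) (exponent x))
                  (theta σ₀ (+ 3 ℤ.* h) (+ 3 ℤ.* a ℤ.- h) 0ℤ * eu
                    + (theta σ₁ (+ 3 ℤ.* h) (+ 3 ℤ.* a ℤ.+ h) a * eu
                    + theta σ₀ (+ 3 ℤ.* h) (+ 3 ℤ.* (a ℤ.+ h)) (+ 2 ℤ.* (a ℤ.+ h))
                      * theta parity (+ 6 ℤ.* h) (ℤ.- (+ 6 ℤ.* h)) 0ℤ))
        parts = hasSum-sublattices 1ℤ 0ℤ 0ℤ 0ℤ
          (hasSum-separable σ₀ parity adm₃ adm₆ (theta-hasSum σ₀ adm₃) reflected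
            (signs′ 0ℤ Sign.+ (s^0 s)) (e₀ h a))
          (hasSum-separable σ₁ parity adm₄ adm₇ (theta-hasSum σ₁ adm₄) euler
            (signs′ 1ℤ s (s^1 s)) (e₁ h a))
          (hasSum-separable σ₀ parity adm₅ adm₈ (theta-hasSum σ₀ adm₅) (theta-hasSum parity adm₈)
            (signs′ (+ 2) Sign.+ (s^2 s)) (e₂ h a))
          where
          e₀ : ∀ h a t j → ((+ 3 ℤ.* h) ℤ.* (t ℤ.* t) ℤ.+ (+ 3 ℤ.* a ℤ.- h) ℤ.* t ℤ.+ 0ℤ) ℤ.+ ((+ 6 ℤ.* h) ℤ.* (j ℤ.* j) ℤ.+ (+ 2 ℤ.* h) ℤ.* j ℤ.+ 0ℤ)
              ≡ (h ℤ.* ((+ 3 ℤ.* t ℤ.+ 0ℤ ℤ.- ((1ℤ ℤ.* t ℤ.+ j ℤ.+ 0ℤ) ℤ.+ (1ℤ ℤ.* t ℤ.+ j ℤ.+ 0ℤ)))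
                ℤ.* (+ 3 ℤ.* t ℤ.+ 0ℤ ℤ.- ((1ℤ ℤ.* t ℤ.+ j ℤ.+ 0ℤ) ℤ.+ (1ℤ ℤ.* t ℤ.+ j ℤ.+ 0ℤ))))
                ℤ.+ (a ℤ.- h) ℤ.* (+ 3 ℤ.* t ℤ.+ 0ℤ ℤ.- ((1ℤ ℤ.* t ℤ.+ j ℤ.+ 0ℤ) ℤ.+ (1ℤ ℤ.* t ℤ.+ j
                ℤ.+ 0ℤ))) ℤ.+ 0ℤ) ℤ.+ ((h ℤ.+ h) ℤ.* ((1ℤ ℤ.* t ℤ.+ j ℤ.+ 0ℤ) ℤ.* (1ℤ ℤ.* t ℤ.+ j ℤ.+ 0ℤ))
                ℤ.+ (a ℤ.+ a) ℤ.* (1ℤ ℤ.* t ℤ.+ j ℤ.+ 0ℤ) ℤ.+ 0ℤ)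
          e₀ = solve-∀
          e₁ : ∀ h a t j → ((+ 3 ℤ.* h) ℤ.* (t ℤ.* t) ℤ.+ (+ 3 ℤ.* a ℤ.+ h) ℤ.* t ℤ.+ a) ℤ.+ ((+ 6 ℤ.* h)
                ℤ.* (j ℤ.* j) ℤ.+ (ℤ.- (+ 2 ℤ.* h)) ℤ.* j ℤ.+ 0ℤ)
              ≡ (h ℤ.* ((+ 3 ℤ.* t ℤ.+ 1ℤ ℤ.- ((1ℤ ℤ.* t ℤ.+ j ℤ.+ 0ℤ) ℤ.+ (1ℤ ℤ.* t ℤ.+ j ℤ.+ 0ℤ)))
                ℤ.* (+ 3 ℤ.* t ℤ.+ 1ℤ ℤ.- ((1ℤ ℤ.* t ℤ.+ j ℤ.+ 0ℤ) ℤ.+ (1ℤ ℤ.* t ℤ.+ j ℤ.+ 0ℤ))))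
                ℤ.+ (a ℤ.- h) ℤ.* (+ 3 ℤ.* t ℤ.+ 1ℤ ℤ.- ((1ℤ ℤ.* t ℤ.+ j ℤ.+ 0ℤ) ℤ.+ (1ℤ ℤ.* t ℤ.+ j
                ℤ.+ 0ℤ))) ℤ.+ 0ℤ) ℤ.+ ((h ℤ.+ h) ℤ.* ((1ℤ ℤ.* t ℤ.+ j ℤ.+ 0ℤ) ℤ.* (1ℤ ℤ.* t ℤ.+ j ℤ.+ 0ℤ))
                ℤ.+ (a ℤ.+ a) ℤ.* (1ℤ ℤ.* t ℤ.+ j ℤ.+ 0ℤ) ℤ.+ 0ℤ)
          e₁ = solve-∀
          e₂ : ∀ h a t j → ((+ 3 ℤ.* h) ℤ.* (t ℤ.* t) ℤ.+ (+ 3 ℤ.* (a ℤ.+ h)) ℤ.* t ℤ.+ (+ 2 ℤ.* (a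
                ℤ.+ h))) ℤ.+ ((+ 6 ℤ.* h) ℤ.* (j ℤ.* j) ℤ.+ (ℤ.- (+ 6 ℤ.* h)) ℤ.* j ℤ.+ 0ℤ)
              ≡ (h ℤ.* ((+ 3 ℤ.* t ℤ.+ + 2 ℤ.- ((1ℤ ℤ.* t ℤ.+ j ℤ.+ 0ℤ) ℤ.+ (1ℤ ℤ.* t ℤ.+ j ℤ.+ 0ℤ)))
                ℤ.* (+ 3 ℤ.* t ℤ.+ + 2 ℤ.- ((1ℤ ℤ.* t ℤ.+ j ℤ.+ 0ℤ) ℤ.+ (1ℤ ℤ.* t ℤ.+ j ℤ.+ 0ℤ))))
                ℤ.+ (a ℤ.- h) ℤ.* (+ 3 ℤ.* t ℤ.+ + 2 ℤ.- ((1ℤ ℤ.* t ℤ.+ j ℤ.+ 0ℤ) ℤ.+ (1ℤ ℤ.* t ℤ.+ j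
                ℤ.+ 0ℤ))) ℤ.+ 0ℤ) ℤ.+ ((h ℤ.+ h) ℤ.* ((1ℤ ℤ.* t ℤ.+ j ℤ.+ 0ℤ) ℤ.* (1ℤ ℤ.* t ℤ.+ j ℤ.+ 0ℤ))
                ℤ.+ (a ℤ.+ a) ℤ.* (1ℤ ℤ.* t ℤ.+ j ℤ.+ 0ℤ) ℤ.+ 0ℤ)
          e₂ = solve-∀

      -- The product of two triple products is a double sum. Split by x modulo 3, it yields Euler's
      -- series in base q^(4h) as a factor on the classes 0 and 1, and zero on the class 2.
      quintupleProduct : j₁ * j₂ ≈ eu * (theta σ₀ (+ 3 ℤ.* h) (+ 3 ℤ.* a ℤ.- h) 0ℤ
                                       + theta σ₁ (+ 3 ℤ.* h) (+ 3 ℤ.* a ℤ.+ h) a)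
      quintupleProduct = begin
        j₁ * j₂                                          ≈⟨ hasSum-unique _≟²_ whole parts ⟩
        θ₀ * eu + (θ₁ * eu + θ₂ * _)                     ≈⟨ +-congˡ (+-congˡ (*-congˡ antisymmetric)) ⟩
        θ₀ * eu + (θ₁ * eu + θ₂ * 0#)
          ≈⟨ solve 4 (λ x y z e → x :* e :+ (y :* e :+ z :* con 0) := e :* (x :+ y)) refl θ₀ θ₁ θ₂ eu ⟩
        eu * (θ₀ + θ₁)                                   ∎
        where
        θ₀ = theta σ₀ (+ 3 ℤ.* h) (+ 3 ℤ.* a ℤ.- h) 0ℤ
        θ₁ = theta σ₁ (+ 3 ℤ.* h) (+ 3 ℤ.* a ℤ.+ h) a
        θ₂ = theta σ₀ (+ 3 ℤ.* h) (+ 3 ℤ.* (a ℤ.+ h)) (+ 2 ℤ.* (a ℤ.+ h))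

-- Binary quadratic polynomials and their separation on a coset.

admissible! : ∀ {A B C} {_ : True (admissible? A B C)} → Admissible A B C
admissible! {_} {_} {_} {ok} = toWitness ok

form : ℤ → ℤ → ℤ → ℤ → ℤ → ℤ → ℤ → ℤ → ℤ
form α β γ δ ε ζ t b = α ℤ.* (t ℤ.* t) ℤ.+ β ℤ.* (t ℤ.* b) ℤ.+ γ ℤ.* (b ℤ.* b) ℤ.+ δ ℤ.* t ℤ.+ ε ℤ.* b ℤ.+ ζ

-- The hypothesis is the vanishing of the coefficient of i·l. The number C′ is free: it shares out
-- the constant term so that both exponents can be non-negative.
form-separates : ∀ α β γ δ ε ζ c ρ d C′ → + 3 ℤ.* β ℤ.+ + 2 ℤ.* γ ℤ.* c ≡ 0ℤ → ∀ i l →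
  quad (+ 9 ℤ.* α ℤ.+ + 3 ℤ.* β ℤ.* c ℤ.+ γ ℤ.* (c ℤ.* c))
       (+ 6 ℤ.* α ℤ.* ρ ℤ.+ + 3 ℤ.* β ℤ.* d ℤ.+ β ℤ.* c ℤ.* ρ ℤ.+ + 2 ℤ.* γ ℤ.* c ℤ.* d ℤ.+ + 3 ℤ.* δ ℤ.+ ε ℤ.* c)
       (form α β γ δ ε ζ ρ d ℤ.- C′) i
  ℤ.+ quad γ (β ℤ.* ρ ℤ.+ + 2 ℤ.* γ ℤ.* d ℤ.+ ε) C′ l
  ≡ form α β γ δ ε ζ (+ 3 ℤ.* i ℤ.+ ρ) (c ℤ.* i ℤ.+ l ℤ.+ d)
form-separates α β γ δ ε ζ c ρ d C′ mixed i l =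
  ≡.trans (pad (i ℤ.* l) mixed) (expand α β γ δ ε ζ c ρ d C′ i l)
  where
  pad : ∀ {x z} y → z ≡ 0ℤ → x ≡ x ℤ.+ z ℤ.* y
  pad {x} y ≡.refl = ≡.sym (ℤₚ.+-identityʳ x)
  expand : ∀ α β γ δ ε ζ c ρ d C′ i l →
    (+ 9 ℤ.* α ℤ.+ + 3 ℤ.* β ℤ.* c ℤ.+ γ ℤ.* (c ℤ.* c)) ℤ.* (i ℤ.* i)
    ℤ.+ (+ 6 ℤ.* α ℤ.* ρ ℤ.+ + 3 ℤ.* β ℤ.* d ℤ.+ β ℤ.* c ℤ.* ρ ℤ.+ + 2 ℤ.* γ ℤ.* c ℤ.* d ℤ.+ + 3 ℤ.* δ ℤ.+ ε ℤ.* c) ℤ.* i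
    ℤ.+ (α ℤ.* (ρ ℤ.* ρ) ℤ.+ β ℤ.* (ρ ℤ.* d) ℤ.+ γ ℤ.* (d ℤ.* d) ℤ.+ δ ℤ.* ρ ℤ.+ ε ℤ.* d ℤ.+ ζ ℤ.- C′)
    ℤ.+ (γ ℤ.* (l ℤ.* l) ℤ.+ (β ℤ.* ρ ℤ.+ + 2 ℤ.* γ ℤ.* d ℤ.+ ε) ℤ.* l ℤ.+ C′)
    ℤ.+ (+ 3 ℤ.* β ℤ.+ + 2 ℤ.* γ ℤ.* c) ℤ.* (i ℤ.* l)
    ≡ α ℤ.* ((+ 3 ℤ.* i ℤ.+ ρ) ℤ.* (+ 3 ℤ.* i ℤ.+ ρ)) ℤ.+ β ℤ.* ((+ 3 ℤ.* i ℤ.+ ρ) ℤ.* (c ℤ.* i ℤ.+ l ℤ.+ d))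
      ℤ.+ γ ℤ.* ((c ℤ.* i ℤ.+ l ℤ.+ d) ℤ.* (c ℤ.* i ℤ.+ l ℤ.+ d)) ℤ.+ δ ℤ.* (+ 3 ℤ.* i ℤ.+ ρ) ℤ.+ ε ℤ.* (c ℤ.* i ℤ.+ l ℤ.+ d) ℤ.+ ζ
  expand = solve-∀

quad-reflect : ∀ A B C c t → quad A B C (c ℤ.- t) ≡
               quad A (ℤ.- (+ 2 ℤ.* A ℤ.* c ℤ.+ B)) (A ℤ.* (c ℤ.* c) ℤ.+ B ℤ.* c ℤ.+ C) t
quad-reflect = expand
  where
  expand : ∀ A B C c t → A ℤ.* ((c ℤ.- t) ℤ.* (c ℤ.- t)) ℤ.+ B ℤ.* (c ℤ.- t) ℤ.+ C ≡
    A ℤ.* (t ℤ.* t) ℤ.+ (ℤ.- (+ 2 ℤ.* A ℤ.* c ℤ.+ B)) ℤ.* t ℤ.+ (A ℤ.* (c ℤ.* c) ℤ.+ B ℤ.* c ℤ.+ C)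
  expand = solve-∀

parity-sub : ∀ c t → parity (c ℤ.- t) ≡ parity (t ℤ.+ c)
parity-sub c t = parity-congruent (t ℤ.+ c) (ℤ.- t) (rearrange c t)
  where
  rearrange : ∀ c t → c ℤ.- t ≡ t ℤ.+ c ℤ.+ (ℤ.- t ℤ.+ ℤ.- t)
  rearrange = solve-∀

parity-+suc : ∀ t d → parity (t ℤ.+ ℤ.suc d) ≡ opposite (parity (t ℤ.+ d))
parity-+suc t d = ≡.trans (≡.cong parity (rearrange t d)) (parity-suc (t ℤ.+ d))
  where
  rearrange : ∀ t d → t ℤ.+ (1ℤ ℤ.+ d) ≡ 1ℤ ℤ.+ (t ℤ.+ d)
  rearrange = solve-∀

-- The lattice identity D·(q²;q²) = C·E.

module KeyIdentity (T : TruncatedPowers) where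

  open TruncatedPowers T
  open CommutativeRing commutativeRing
  open Summation commutativeRing
  open Theta T
  open Products T
  open Solver using (solve; _:=_; _:+_; _:*_; con)
  open import Algebra.Properties.Ring ring using (-1*x≈-x; -‿involutive)
  open import Relation.Binary.Reasoning.Setoid setoid

  -- Admissibility travels with the sum, since multiplication needs non-negative exponents. The
  -- value `s` is a parameter so that a reflected or translated series keeps the value of the
  -- original.
  record ThetaSum (σ : ℤ → Sign) (A B C : ℤ) (s : Carrier) : Set where
    constructor thetaSum
    field
      isAdmissible : Admissible A B C
      hasSum       : HasSum (λ t → term (σ t) (quad A B C t)) s
  open ThetaSum

  thetaOf : ∀ σ A B C {_ : True (admissible? A B C)} → ThetaSum σ A B C (theta σ A B C)
  thetaOf σ A B C {adm} = thetaSum (toWitness adm) (theta-hasSum σ (toWitness adm))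

  plus minus : ℤ → Sign
  plus  _ = Sign.+
  minus _ = Sign.-

  parity+ : ℤ → ℤ → Sign
  parity+ d t = parity (t ℤ.+ d)

  resign : ∀ {σ A B C s} σ′ → (∀ t → σ t ≡ σ′ t) → ThetaSum σ A B C s → ThetaSum σ′ A B C s
  resign σ′ signs (thetaSum adm H) = thetaSum adm (hasSum-cong (λ t → reflexive (≡.cong (λ u → u ◃ _) (signs t))) refl H)

  negate : ∀ {σ A B C s} σ′ → (∀ t → σ′ t ≡ opposite (σ t)) → ThetaSum σ A B C s → ThetaSum σ′ A B C (- s)
  negate {σ} {A} {B} {C} σ′ signs (thetaSum adm H) = thetaSum adm (hasSum-cong
    (λ t → trans (sym (◃-opposite (σ t) (mono (quad A B C t))))
                 (reflexive (≡.cong (λ u → u ◃ mono (quad A B C t)) (≡.sym (signs t)))))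
    refl (hasSum-neg H))

  reflect : ∀ c {σ A B C s} σ′ → (∀ t → σ (c ℤ.- t) ≡ σ′ t) → ThetaSum σ A B C s →
    let B′ = ℤ.- (+ 2 ℤ.* A ℤ.* c ℤ.+ B) ; C′ = A ℤ.* (c ℤ.* c) ℤ.+ B ℤ.* c ℤ.+ C in
    {_ : True (admissible? A B′ C′)} → ThetaSum σ′ A B′ C′ s
  reflect c {σ} {A} {B} {C} σ′ signs (thetaSum _ H) {adm} = thetaSum (toWitness adm)
    (hasSum-cong (λ t → term-≡ (signs t) (quad-reflect A B C c t)) refl (hasSum-reflect c H))

  antisymmetric : ∀ c {d A B C s} (k : ℤ → ℤ) → (∀ t → c ℤ.- t ℤ.+ d ≡ ℤ.suc (t ℤ.+ d) ℤ.+ (k t ℤ.+ k t)) →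
    ThetaSum (parity+ d) A B C s → ℤ.- (+ 2 ℤ.* A ℤ.* c ℤ.+ B) ≡ B → A ℤ.* (c ℤ.* c) ℤ.+ B ℤ.* c ℤ.+ C ≡ C → s ≈ 0#
  antisymmetric c {d} {A} {B} {C} k odd (thetaSum _ H) B′≡B C′≡C = antisymmetric⇒0 c (λ t → trans
    (term-≡ (≡.trans (parity-congruent (ℤ.suc (t ℤ.+ d)) (k t) (odd t)) (parity-suc (t ℤ.+ d)))
            (≡.trans (quad-reflect A B C c t) (≡.cong₂ (λ B C → quad A B C t) B′≡B C′≡C)))
    (◃-opposite (parity+ d t) (mono (quad A B C t)))) H

  separable : ∀ {σ τ A B C A′ B′ C′ s t} {sign : ℤ × ℤ → Sign} {exponent : ℤ × ℤ → ℤ} →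
    ThetaSum σ A B C s → ThetaSum τ A′ B′ C′ t →
    (∀ i l → σ i Sign.* τ l ≡ sign (i , l)) →
    (∀ i l → quad A B C i ℤ.+ quad A′ B′ C′ l ≡ exponent (i , l)) →
    HasSum (λ x → term (sign x) (exponent x)) (s * t)
  separable {σ} {τ} (thetaSum adm H) (thetaSum adm′ K) = hasSum-separable σ τ adm adm′ H K

  parity-+0 : ∀ t → parity t ≡ parity+ 0ℤ t
  parity-+0 t = ≡.cong parity (≡.sym (ℤₚ.+-identityʳ t))

  parity-+2 : ∀ t d → parity+ d t ≡ parity+ (+ 2 ℤ.+ d) t
  parity-+2 t d = ≡.sym (parity-congruent (t ℤ.+ d) 1ℤ (rearrange t d))
    where
    rearrange : ∀ t d → t ℤ.+ (+ 2 ℤ.+ d) ≡ t ℤ.+ d ℤ.+ (1ℤ ℤ.+ 1ℤ)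
    rearrange = solve-∀

  -- Put σ = ±1, k = 40t + 16σ - 5, n = 8t - 6b + 2σ - 1, K = 24t - 8b + 8σ - 3 and
  -- j = 5b + σ, so that 4j + K√-5 = (k + 2n√-5)(2 + √-5)/3.  The exponent is
  -- (k² + 20n² - 141)/240 = (5K² + 16j² - 141)/240.
  summand₊ summand₋ : ℤ × ℤ → Carrier
  summand₊ (t , b) = term (parity b) (form (+ 12) (ℤ.- + 8) (+ 3) (+ 5) -1ℤ 0ℤ t b)
  summand₋ (t , b) = term (parity b) (form (+ 12) (ℤ.- + 8) (+ 3) (ℤ.- + 11) (+ 3) (+ 2) t b)

  -- The factor in n at the points with k = 120i + 51 and n = 3 - 6l, both divisible by 3. Its
  -- exponent is invariant under t ↦ 1 - t, its sign is not.
  vanishing₊ : theta (parity+ 1ℤ) (+ 3) (ℤ.- + 3) 0ℤ ≈ 0#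
  vanishing₊ = antisymmetric 1ℤ ℤ.-_ rearrange (thetaOf (parity+ 1ℤ) (+ 3) (ℤ.- + 3) 0ℤ) ≡.refl ≡.refl
    where
    rearrange : ∀ t → 1ℤ ℤ.- t ℤ.+ 1ℤ ≡ 1ℤ ℤ.+ (t ℤ.+ 1ℤ) ℤ.+ (ℤ.- t ℤ.+ ℤ.- t)
    rearrange = solve-∀

  vanishing₋ : theta (parity+ 0ℤ) (+ 3) (+ 3) 0ℤ ≈ 0#
  vanishing₋ = antisymmetric -1ℤ (λ t → -1ℤ ℤ.- t) rearrange (thetaOf (parity+ 0ℤ) (+ 3) (+ 3) 0ℤ) ≡.refl ≡.refl
    where
    rearrange : ∀ t → -1ℤ ℤ.- t ℤ.+ 0ℤ ≡ 1ℤ ℤ.+ (t ℤ.+ 0ℤ) ℤ.+ ((-1ℤ ℤ.- t) ℤ.+ (-1ℤ ℤ.- t))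
    rearrange = solve-∀

  module _ {eu : Carrier} (euler : ThetaSum parity (+ 3) -1ℤ 0ℤ eu) where

    private
      θ : ℤ → ℤ → Carrier
      θ = theta plus (+ 60)

      euler₀ : ThetaSum (parity+ 0ℤ) (+ 3) 1ℤ 0ℤ eu
      euler₀ = reflect 0ℤ (parity+ 0ℤ) (parity-sub 0ℤ) euler

      euler₁ : ThetaSum (parity+ 1ℤ) (+ 3) (ℤ.- + 5) (+ 2) eu
      euler₁ = reflect 1ℤ (parity+ 1ℤ) (parity-sub 1ℤ) euler

      euler₂ : ThetaSum (parity+ 0ℤ) (+ 3) -1ℤ 0ℤ eu
      euler₂ = resign (parity+ 0ℤ) parity-+0 euler

      signs : ∀ d i l → Sign.+ Sign.* parity+ d l ≡ parity (+ 4 ℤ.* i ℤ.+ l ℤ.+ d)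
      signs d i l = ≡.sym (parity-congruent (l ℤ.+ d) (i ℤ.+ i) (rearrange d i l))
        where
        rearrange : ∀ d i l → + 4 ℤ.* i ℤ.+ l ℤ.+ d ≡ l ℤ.+ d ℤ.+ ((i ℤ.+ i) ℤ.+ (i ℤ.+ i))
        rearrange = solve-∀

    -- c = 4 makes n independent of i: on the three cosets k = 120i + 11, 120i + 51, 120i + 91 and n
    -- = 1 - 6l, 3 - 6l, 5 - 6l.
    source₊ : HasSum summand₊ (θ (+ 11) 0ℤ * eu
                + (θ (+ 51) (+ 11) * theta (parity+ 1ℤ) (+ 3) (ℤ.- + 3) 0ℤ + θ (+ 91) (+ 34) * - eu))
    source₊ = hasSum-sublattices (+ 4) 0ℤ 1ℤ (+ 2)
      (separable (thetaOf plus (+ 60) (+ 11) 0ℤ) euler₂ (signs 0ℤ)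
        (form-separates (+ 12) (ℤ.- + 8) (+ 3) (+ 5) -1ℤ 0ℤ (+ 4) 0ℤ 0ℤ 0ℤ ≡.refl))
      (separable (thetaOf plus (+ 60) (+ 51) (+ 11)) (thetaOf (parity+ 1ℤ) (+ 3) (ℤ.- + 3) 0ℤ) (signs 1ℤ)
        (form-separates (+ 12) (ℤ.- + 8) (+ 3) (+ 5) -1ℤ 0ℤ (+ 4) 1ℤ 1ℤ 0ℤ ≡.refl))
      (separable (thetaOf plus (+ 60) (+ 91) (+ 34))
        (negate (parity+ (+ 2)) (λ t → parity-+suc t 1ℤ) euler₁) (signs (+ 2))
        (form-separates (+ 12) (ℤ.- + 8) (+ 3) (+ 5) -1ℤ 0ℤ (+ 4) (+ 2) (+ 2) (+ 2) ≡.refl))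

    -- Here k = 120i - 21, 120i + 19, 120i + 59 and n = -3 - 6l, -1 - 6l, 1 - 6l. The signs are
    -- opposite to those in `D`, which the later subtraction corrects.
    source₋ : HasSum summand₋ (θ (ℤ.- + 21) (+ 2) * theta (parity+ 0ℤ) (+ 3) (+ 3) 0ℤ
                + (θ (+ 19) 1ℤ * - eu + θ (+ 59) (+ 14) * eu))
    source₋ = hasSum-sublattices (+ 4) 0ℤ 1ℤ (+ 2)
      (separable (thetaOf plus (+ 60) (ℤ.- + 21) (+ 2)) (thetaOf (parity+ 0ℤ) (+ 3) (+ 3) 0ℤ) (signs 0ℤ)
        (form-separates (+ 12) (ℤ.- + 8) (+ 3) (ℤ.- + 11) (+ 3) (+ 2) (+ 4) 0ℤ 0ℤ 0ℤ ≡.refl))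
      (separable (thetaOf plus (+ 60) (+ 19) 1ℤ)
        (negate (parity+ 1ℤ) (λ t → parity-+suc t 0ℤ) euler₀) (signs 1ℤ)
        (form-separates (+ 12) (ℤ.- + 8) (+ 3) (ℤ.- + 11) (+ 3) (+ 2) (+ 4) 1ℤ 1ℤ 0ℤ ≡.refl))
      (separable (thetaOf plus (+ 60) (+ 59) (+ 14))
        (resign (parity+ (+ 2)) (λ t → parity-+2 t 0ℤ) euler₂) (signs (+ 2))
        (form-separates (+ 12) (ℤ.- + 8) (+ 3) (ℤ.- + 11) (+ 3) (+ 2) (+ 4) (+ 2) (+ 2) 0ℤ ≡.refl))

  -- The two halves in which the quintuple product delivers C and E: K = 24t + 5 and 24t + 13,
  -- respectively j = 15t - 1 and 15t + 4.
  C₁ C₂ E₁ E₂ : Carrier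
  C₁ = theta plus   (+ 12) (+ 5) 0ℤ
  C₂ = theta minus  (+ 12) (+ 13) (+ 3)
  E₁ = theta parity (+ 15) (ℤ.- + 2) 0ℤ
  E₂ = theta parity (+ 15) (+ 8) 1ℤ

  private
    C₁′ : ThetaSum plus (+ 12) (ℤ.- + 19) (+ 7) C₁
    -- Two reflections compose to a translation: t is replaced by t - 1.
    C₁′ = reflect 0ℤ plus (λ _ → ≡.refl) (reflect -1ℤ plus (λ _ → ≡.refl) (thetaOf plus (+ 12) (+ 5) 0ℤ))

    C₂′ : ThetaSum plus (+ 12) (ℤ.- + 11) (+ 2) (- C₂)
    C₂′ = negate plus (λ _ → ≡.refl) (reflect 0ℤ minus (λ _ → ≡.refl)
      (reflect -1ℤ minus (λ _ → ≡.refl) (thetaOf minus (+ 12) (+ 13) (+ 3))))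

    E₁′ : ThetaSum (parity+ 0ℤ) (+ 15) (+ 2) 0ℤ E₁
    E₁′ = reflect 0ℤ (parity+ 0ℤ) (parity-sub 0ℤ) (thetaOf parity (+ 15) (ℤ.- + 2) 0ℤ)

    E₁″ : ThetaSum (parity+ 0ℤ) (+ 15) (ℤ.- + 2) 0ℤ E₁
    E₁″ = resign (parity+ 0ℤ) parity-+0 (thetaOf parity (+ 15) (ℤ.- + 2) 0ℤ)

    E₂′ : ThetaSum (parity+ (+ 2)) (+ 15) (+ 22) (+ 8) (- E₂)
    E₂′ = negate (parity+ (+ 2)) (λ t → parity-+suc t 1ℤ) (resign (parity+ 1ℤ) (λ t → parity-+2 t -1ℤ)
      (reflect -1ℤ (parity+ -1ℤ) (parity-sub -1ℤ) (thetaOf parity (+ 15) (+ 8) 1ℤ)))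

    E₂″ : ThetaSum (parity+ 1ℤ) (+ 15) (+ 8) 1ℤ (- E₂)
    E₂″ = negate (parity+ 1ℤ) (λ t → parity-+suc t 0ℤ) (resign (parity+ 0ℤ) parity-+0 (thetaOf parity (+ 15) (+ 8) 1ℤ))

    -- The two factors at the points with j = 15v + 6 and K = 24u - 3, both divisible by 3.
    Z W : Carrier
    Z = theta (parity+ 1ℤ) (+ 15) (+ 12) (+ 2)
    W = theta plus (+ 12) (ℤ.- + 3) 0ℤ

    Z′ : ThetaSum (parity+ (+ 2)) (+ 15) (+ 18) (+ 5) Z
    Z′ = reflect -1ℤ (parity+ (+ 2)) (λ t → parity-congruent (t ℤ.+ + 2) (-1ℤ ℤ.- t) (rearrange t))
           (thetaOf (parity+ 1ℤ) (+ 15) (+ 12) (+ 2))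
      where
      rearrange : ∀ t → -1ℤ ℤ.- t ℤ.+ 1ℤ ≡ t ℤ.+ + 2 ℤ.+ ((-1ℤ ℤ.- t) ℤ.+ (-1ℤ ℤ.- t))
      rearrange = solve-∀

    signs : ∀ ρ v (u : ℤ) → parity+ ρ v Sign.* Sign.+ ≡ parity (+ 3 ℤ.* v ℤ.+ ρ)
    signs ρ v u = ≡.trans (Signₚ.*-identityʳ _) (≡.sym (parity-congruent (v ℤ.+ ρ) v (rearrange v ρ)))
      where
      rearrange : ∀ v ρ → + 3 ℤ.* v ℤ.+ ρ ≡ v ℤ.+ ρ ℤ.+ (v ℤ.+ v)
      rearrange = solve-∀

    form-swap : ∀ α β γ δ ε ζ t b → form α β γ δ ε ζ t b ≡ form γ β α ε δ ζ b t
    form-swap = expand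
      where
      expand : ∀ α β γ δ ε ζ t b →
        α ℤ.* (t ℤ.* t) ℤ.+ β ℤ.* (t ℤ.* b) ℤ.+ γ ℤ.* (b ℤ.* b) ℤ.+ δ ℤ.* t ℤ.+ ε ℤ.* b ℤ.+ ζ ≡
        γ ℤ.* (b ℤ.* b) ℤ.+ β ℤ.* (b ℤ.* t) ℤ.+ α ℤ.* (t ℤ.* t) ℤ.+ ε ℤ.* b ℤ.+ δ ℤ.* t ℤ.+ ζ
      expand = solve-∀

  -- Now b is the coordinate fixed modulo 3, hence the swap, and c = 1 removes the cross term.
  target₊ : HasSum summand₊ (E₁ * C₁ + (Z * W + - E₂ * - C₂))
  target₊ = hasSum-swap (hasSum-cong
    (λ (b , t) → term-≡ {parity b} ≡.refl (form-swap (+ 3) (ℤ.- + 8) (+ 12) -1ℤ (+ 5) 0ℤ b t)) refl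
    (hasSum-sublattices 1ℤ 0ℤ 0ℤ 0ℤ
      (separable E₁′ (thetaOf plus (+ 12) (+ 5) 0ℤ) (signs 0ℤ)
        (form-separates (+ 3) (ℤ.- + 8) (+ 12) -1ℤ (+ 5) 0ℤ 1ℤ 0ℤ 0ℤ 0ℤ ≡.refl))
      (separable (thetaOf (parity+ 1ℤ) (+ 15) (+ 12) (+ 2)) (thetaOf plus (+ 12) (ℤ.- + 3) 0ℤ) (signs 1ℤ)
        (form-separates (+ 3) (ℤ.- + 8) (+ 12) -1ℤ (+ 5) 0ℤ 1ℤ 1ℤ 0ℤ 0ℤ ≡.refl))
      (separable E₂′ C₂′ (signs (+ 2))
        (form-separates (+ 3) (ℤ.- + 8) (+ 12) -1ℤ (+ 5) 0ℤ 1ℤ (+ 2) 0ℤ (+ 2) ≡.refl))))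

  -- Z·W turns up again, on the coset b ≡ 2 instead of b ≡ 1, and so leaves the difference of the
  -- two sums.
  target₋ : HasSum summand₋ (E₁ * - C₂ + (- E₂ * C₁ + Z * W))
  target₋ = hasSum-swap (hasSum-cong
    (λ (b , t) → term-≡ {parity b} ≡.refl (form-swap (+ 3) (ℤ.- + 8) (+ 12) (+ 3) (ℤ.- + 11) (+ 2) b t)) refl
    (hasSum-sublattices 1ℤ 0ℤ 0ℤ 1ℤ
      (separable E₁″ C₂′ (signs 0ℤ)
        (form-separates (+ 3) (ℤ.- + 8) (+ 12) (+ 3) (ℤ.- + 11) (+ 2) 1ℤ 0ℤ 0ℤ (+ 2) ≡.refl))
      (separable E₂″ C₁′ (signs 1ℤ)
        (form-separates (+ 3) (ℤ.- + 8) (+ 12) (+ 3) (ℤ.- + 11) (+ 2) 1ℤ 1ℤ 0ℤ (+ 7) ≡.refl))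
      (separable Z′ (thetaOf plus (+ 12) (ℤ.- + 3) 0ℤ) (signs (+ 2))
        (form-separates (+ 3) (ℤ.- + 8) (+ 12) (+ 3) (ℤ.- + 11) (+ 2) 1ℤ (+ 2) 1ℤ 0ℤ ≡.refl))))

  theta60 : ℤ → ℤ → Carrier
  theta60 = theta plus (+ 60)

  D : Carrier
  D = theta60 (+ 11) 0ℤ + theta60 (+ 19) 1ℤ - theta60 (+ 59) (+ 14) - theta60 (+ 91) (+ 34)

  private
    -- -1 as an atom: the semiring solver handles signs as a variable, and `m*m` and `1+m` supply
    -- the two facts about it.
    m : Carrier
    m = - 1#

    neg : ∀ x → - x ≈ m * x
    neg x = sym (-1*x≈-x x)

    1+m : 1# + m ≈ 0#
    1+m = -‿inverseʳ 1#

    m*m : m * m ≈ 1#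
    m*m = trans (-1*x≈-x m) (-‿involutive 1#)

  -- Both sides are the sum of `summand₊` minus the sum of `summand₋`, evaluated once by t modulo 3
  -- and once by b modulo 3.
  euler*D≈E*C : ∀ {eu} → ThetaSum parity (+ 3) -1ℤ 0ℤ eu → eu * D ≈ (E₁ + E₂) * (C₁ + C₂)
  euler*D≈E*C {eu} euler = begin
    eu * (a + b - c - d)
      ≈⟨ *-congˡ (+-cong (+-congˡ (neg c)) (neg d)) ⟩
    eu * (a + b + m * c + m * d)
      ≈⟨ *-congˡ (+-congʳ (+-congʳ (+-congˡ (trans (*-congʳ m*m) (*-identityˡ b))))) ⟨
    eu * (a + m * m * b + m * c + m * d)
      ≈⟨ solve 8 (λ eu a b c d m x y →
           eu :* (a :+ m :* m :* b :+ m :* c :+ m :* d)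
           := a :* eu :+ (x :* con 0 :+ d :* (m :* eu)) :+ m :* (y :* con 0 :+ (b :* (m :* eu) :+ c :* eu)))
           refl eu a b c d m x y ⟩
    (a * eu + (x * 0# + d * (m * eu))) + m * (y * 0# + (b * (m * eu) + c * eu))
      ≈⟨ +-cong (+-congˡ (+-cong (*-congˡ vanishing₊) (*-congˡ (neg eu))))
           (*-congˡ (+-cong (*-congˡ vanishing₋) (+-congʳ (*-congˡ (neg eu))))) ⟨
    (a * eu + (x * _ + d * - eu)) + m * (y * _ + (b * - eu + c * eu))
      ≈⟨ +-cong (hasSum-unique _≟²_ (source₊ euler) target₊)
                (*-congˡ (hasSum-unique _≟²_ (source₋ euler) target₋)) ⟩
    (E₁ * C₁ + (Z * W + - E₂ * - C₂)) + m * (E₁ * - C₂ + (- E₂ * C₁ + Z * W))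
      ≈⟨ +-cong (+-congˡ (+-congˡ (*-cong (neg E₂) (neg C₂))))
           (*-congˡ (+-cong (*-congˡ (neg C₂)) (+-congʳ (*-congʳ (neg E₂))))) ⟩
    (E₁ * C₁ + (Z * W + m * E₂ * (m * C₂))) + m * (E₁ * (m * C₂) + (m * E₂ * C₁ + Z * W))
      ≈⟨ solve 6 (λ e f c d z m →
           (e :* c :+ (z :+ m :* f :* (m :* d))) :+ m :* (e :* (m :* d) :+ (m :* f :* c :+ z))
           := e :* c :+ m :* m :* (f :* d :+ e :* d :+ f :* c) :+ (con 1 :+ m) :* z)
           refl E₁ E₂ C₁ C₂ (Z * W) m ⟩
    E₁ * C₁ + m * m * (E₂ * C₂ + E₁ * C₂ + E₂ * C₁) + (1# + m) * (Z * W)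
      ≈⟨ +-cong (+-congˡ (*-congʳ m*m)) (*-congʳ 1+m) ⟩
    E₁ * C₁ + 1# * (E₂ * C₂ + E₁ * C₂ + E₂ * C₁) + 0# * (Z * W)
      ≈⟨ solve 5 (λ e f c d z →
           e :* c :+ con 1 :* (f :* d :+ e :* d :+ f :* c) :+ con 0 :* z := (e :+ f) :* (c :+ d))
           refl E₁ E₂ C₁ C₂ (Z * W) ⟩
    (E₁ + E₂) * (C₁ + C₂) ∎
    where
    a = theta60 (+ 11) 0ℤ
    b = theta60 (+ 19) 1ℤ
    c = theta60 (+ 59) (+ 14)
    d = theta60 (+ 91) (+ 34)
    x = theta60 (+ 51) (+ 11)
    y = theta60 (ℤ.- + 21) (+ 2)

  -- From theta series to infinite products.

  private
    P : ℕ → ℕ → Carrier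
    P = prod∞ Sign.-

    cancel : ∀ {w} → 1 ℕ.≤ w → ∀ {x y} → P w w * x ≈ P w w * y → x ≈ y
    cancel {w} 1≤w {x} {y} eq = begin
      x                 ≈⟨ unit x ⟨
      r * (P w w * x)   ≈⟨ *-congˡ eq ⟩
      r * (P w w * y)   ≈⟨ unit y ⟩
      y                 ∎
      where
      r = recips w (+ suc N)
      unit : ∀ z → r * (P w w * z) ≈ z
      unit z = begin
        r * (P w w * z) ≈⟨ solve 3 (λ r p z → r :* (p :* z) := p :* r :* z) refl r (P w w) z ⟩
        P w w * r * z   ≈⟨ *-congʳ (recips-stable 1≤w ℤₚ.≤-refl) ⟩
        1# * z          ≈⟨ *-identityˡ z ⟩
        z               ∎

    -- The triple product with a = w and b = 2w gives Euler's series as three products modulo 3w,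
    -- which reassemble here.
    eulerProduct : ∀ w → 1 ℕ.≤ w → P w (w ℕ.* 3) * P (w ℕ.+ w ℕ.* 1) (w ℕ.* 3) * P (w ℕ.+ w ℕ.* 2) (w ℕ.* 3) ≈ P w w
    eulerProduct w 1≤w = sym (begin
      P w w ≈⟨ prod∞-split Sign.- w w 3 1≤w (s≤s z≤n) ⟩
      1# * P (w ℕ.+ w ℕ.* 0) (w ℕ.* 3) * P (w ℕ.+ w ℕ.* 1) (w ℕ.* 3) * P (w ℕ.+ w ℕ.* 2) (w ℕ.* 3)
        ≈⟨ *-congʳ (*-congʳ (trans (*-identityˡ _) (reflexive (≡.cong (λ r → P r (w ℕ.* 3))
             (≡.trans (≡.cong (w ℕ.+_) (ℕₚ.*-zeroʳ w)) (ℕₚ.+-identityʳ w)))))) ⟩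
      P w (w ℕ.* 3) * P (w ℕ.+ w ℕ.* 1) (w ℕ.* 3) * P (w ℕ.+ w ℕ.* 2) (w ℕ.* 3) ∎)

    module Euler2  = TripleProduct Sign.- 2 4 3 ≡.refl (s≤s z≤n) admissible!
    module Euler16 = TripleProduct Sign.- 16 32 24 ≡.refl (s≤s z≤n) admissible!
    module Euler20 = TripleProduct Sign.- 20 40 30 ≡.refl (s≤s z≤n) admissible!
    module TripleC₁ = TripleProduct Sign.- 3 5 4 ≡.refl (s≤s z≤n) admissible!
    module TripleC₂ = TripleProduct Sign.- 14 2 8 ≡.refl (s≤s z≤n) admissible!
    module TripleE₁ = TripleProduct Sign.+ 1 9 5 ≡.refl (s≤s z≤n) admissible!
    module TripleE₂ = TripleProduct Sign.- 12 8 10 ≡.refl (s≤s z≤n) admissible!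
    module QuintupleC = QuintupleProduct Sign.- (+ 4) (+ 3)
      admissible! admissible! admissible! admissible! admissible! admissible! admissible! admissible!
    module QuintupleE = QuintupleProduct Sign.+ (+ 5) (+ 1)
      admissible! admissible! admissible! admissible! admissible! admissible! admissible! admissible!

  -- The quintuple product leaves (q¹⁶;q¹⁶) on both sides: as Euler's series on one, as the last
  -- factor of a triple product on the other.
  C-product : C₁ + C₂ ≈ P 3 8 * P 5 8 * P 8 8 * (P 2 16 * P 14 16)
  C-product = cancel {16} (s≤s z≤n) (begin
    P 16 16 * (C₁ + C₂)
      ≈⟨ *-congʳ (eulerProduct 16 (s≤s z≤n)) ⟨
    P 16 48 * P 32 48 * P 48 48 * (C₁ + C₂)
      ≈⟨ QuintupleC.quintupleProduct TripleC₁.tripleProduct TripleC₂.tripleProduct Euler16.tripleProduct ⟨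
    P 3 8 * P 5 8 * P 8 8 * (P 14 16 * P 2 16 * P 16 16)
      ≈⟨ solve 4 (λ x a b w → x :* (a :* b :* w) := w :* (x :* (b :* a))) refl
           (P 3 8 * P 5 8 * P 8 8) (P 14 16) (P 2 16) (P 16 16) ⟩
    P 16 16 * (P 3 8 * P 5 8 * P 8 8 * (P 2 16 * P 14 16)) ∎)

  E-product : E₁ + E₂ ≈ prod∞ Sign.+ 1 10 * prod∞ Sign.+ 9 10 * P 10 10 * (P 12 20 * P 8 20)
  E-product = cancel {20} (s≤s z≤n) (begin
    P 20 20 * (E₁ + E₂)
      ≈⟨ *-congʳ (eulerProduct 20 (s≤s z≤n)) ⟨
    P 20 60 * P 40 60 * P 60 60 * (E₁ + E₂)
      ≈⟨ QuintupleE.quintupleProduct TripleE₁.tripleProduct TripleE₂.tripleProduct Euler20.tripleProduct ⟨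
    prod∞ Sign.+ 1 10 * prod∞ Sign.+ 9 10 * P 10 10 * (P 12 20 * P 8 20 * P 20 20)
      ≈⟨ solve 3 (λ x y w → x :* (y :* w) := w :* (x :* y)) refl
           (prod∞ Sign.+ 1 10 * prod∞ Sign.+ 9 10 * P 10 10) (P 12 20 * P 8 20) (P 20 20) ⟩
    P 20 20 * (prod∞ Sign.+ 1 10 * prod∞ Sign.+ 9 10 * P 10 10 * (P 12 20 * P 8 20)) ∎)

  -- (-q,-q⁹;q¹⁰)(q,q⁹;q¹⁰) = (q²,q¹⁸;q²⁰), and dissecting the other factors modulo 20 gives each
  -- remaining even residue once.
  E-cancels : (E₁ + E₂) * (P 1 5 * P 4 5) ≈ P 2 2
  E-cancels = begin
    (E₁ + E₂) * (P 1 5 * P 4 5)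
      ≈⟨ *-cong E-product (*-cong (prod∞-split Sign.- 1 5 2 (s≤s z≤n) (s≤s z≤n))
                                  (prod∞-split Sign.- 4 5 2 (s≤s z≤n) (s≤s z≤n))) ⟩
    p₁ * p₉ * P 10 10 * (P 12 20 * P 8 20) * (1# * P 1 10 * P 6 10 * (1# * P 4 10 * P 9 10))
      ≈⟨ solve 9 (λ a b c d e f g h i →
           a :* b :* c :* (d :* e) :* (con 1 :* f :* g :* (con 1 :* h :* i))
           := (a :* f) :* (b :* i) :* (c :* g :* h) :* (d :* e)) refl
           p₁ p₉ (P 10 10) (P 12 20) (P 8 20) (P 1 10) (P 6 10) (P 4 10) (P 9 10) ⟩
    (p₁ * P 1 10) * (p₉ * P 9 10) * (P 10 10 * P 6 10 * P 4 10) * (P 12 20 * P 8 20)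
      ≈⟨ *-congʳ (*-cong (*-cong (prod-± 1 10 (suc N)) (prod-± 9 10 (suc N)))
           (*-cong (*-cong (prod∞-split Sign.- 10 10 2 (s≤s z≤n) (s≤s z≤n))
                           (prod∞-split Sign.- 6 10 2 (s≤s z≤n) (s≤s z≤n)))
                   (prod∞-split Sign.- 4 10 2 (s≤s z≤n) (s≤s z≤n)))) ⟩
    P 2 20 * P 18 20 * ((1# * P 10 20 * P 20 20) * (1# * P 6 20 * P 16 20) * (1# * P 4 20 * P 14 20))
      * (P 12 20 * P 8 20)
      ≈⟨ solve 10 (λ a b c d e f g h i j →
           a :* i :* ((con 1 :* e :* j) :* (con 1 :* c :* h) :* (con 1 :* b :* g)) :* (f :* d)
           := con 1 :* a :* b :* c :* d :* e :* f :* g :* h :* i :* j) refl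
           (P 2 20) (P 4 20) (P 6 20) (P 8 20) (P 10 20) (P 12 20) (P 14 20) (P 16 20) (P 18 20) (P 20 20) ⟩
    1# * P 2 20 * P 4 20 * P 6 20 * P 8 20 * P 10 20 * P 12 20 * P 14 20 * P 16 20 * P 18 20 * P 20 20
      ≈⟨ prod∞-split Sign.- 2 2 10 (s≤s z≤n) (s≤s z≤n) ⟨
    P 2 2 ∎
    where
    p₁ = prod∞ Sign.+ 1 10
    p₉ = prod∞ Sign.+ 9 10

  D-product : D * (P 1 5 * P 4 5) ≈ P 3 8 * P 5 8 * P 8 8 * (P 2 16 * P 14 16)
  D-product = trans (cancel {2} (s≤s z≤n) (begin
    P 2 2 * (D * (P 1 5 * P 4 5))          ≈⟨ *-assoc _ _ _ ⟨
    P 2 2 * D * (P 1 5 * P 4 5)            ≈⟨ *-congʳ (*-congʳ (eulerProduct 2 (s≤s z≤n))) ⟨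
    P 2 6 * P 4 6 * P 6 6 * D * (P 1 5 * P 4 5)
      ≈⟨ *-congʳ (euler*D≈E*C (thetaSum admissible! Euler2.tripleProduct)) ⟩
    (E₁ + E₂) * (C₁ + C₂) * (P 1 5 * P 4 5)
      ≈⟨ solve 3 (λ e c p → e :* c :* p := e :* p :* c) refl (E₁ + E₂) (C₁ + C₂) (P 1 5 * P 4 5) ⟩
    (E₁ + E₂) * (P 1 5 * P 4 5) * (C₁ + C₂) ≈⟨ *-congʳ E-cancels ⟩
    P 2 2 * (C₁ + C₂)                      ∎)) C-product

-- Enumeration of the square roots of 121 modulo 240.

module Roots where

  open import Data.Nat using (_+_; _*_; _<_; _≤_; _%_; _/_)
  open import Relation.Binary.PropositionalEquality using (refl; sym; trans; cong; cong₂; subst; subst₂)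

  strictlyIncreasing⇒mono-≤ : ∀ {f} → StrictlyIncreasing f → ∀ {m n} → m ≤ n → f m ≤ f n
  strictlyIncreasing⇒mono-≤ {f} inc {m} {n} m≤n =
    subst (λ k → f m ≤ f k) (ℕₚ.m∸n+n≡m m≤n) (go (n ℕ.∸ m))
    where
    go : ∀ d → f m ≤ f (d + m)
    go zero    = ℕₚ.≤-refl
    go (suc d) = ℕₚ.≤-trans (go d) (ℕₚ.<⇒≤ (inc (d + m)))

  strictlyIncreasing⇒cancel-< : ∀ {f} → StrictlyIncreasing f → ∀ {m n} → f m < f n → m < n
  strictlyIncreasing⇒cancel-< inc fm<fn =
    ℕₚ.≰⇒> (λ n≤m → ℕₚ.<⇒≱ fm<fn (strictlyIncreasing⇒mono-≤ inc n≤m))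

  strictlyIncreasing⇒n≤f[n] : ∀ {f} → StrictlyIncreasing f → ∀ n → n ≤ f n
  strictlyIncreasing⇒n≤f[n] inc zero    = z≤n
  strictlyIncreasing⇒n≤f[n] inc (suc n) = ℕₚ.≤-<-trans (strictlyIncreasing⇒n≤f[n] inc n) (inc n)

  -- The index m with g m = f n increases strictly with n, so n ≤ m and g n ≤ g m = f n.
  range⊆⇒≤ : ∀ {f g} → StrictlyIncreasing f → StrictlyIncreasing g →
             (∀ n → ∃ λ m → g m ≡ f n) → ∀ n → g n ≤ f n
  range⊆⇒≤ {f} {g} incf incg f⊆g n = subst (g n ≤_) (proj₂ (f⊆g n))
    (strictlyIncreasing⇒mono-≤ incg (strictlyIncreasing⇒n≤f[n] index-increasing n))
    where
    index-increasing : StrictlyIncreasing (proj₁ ∘ f⊆g)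
    index-increasing n = strictlyIncreasing⇒cancel-< incg
      (subst₂ _<_ (sym (proj₂ (f⊆g n))) (sym (proj₂ (f⊆g (suc n)))) (incf n))

  range≡⇒≡ : ∀ {f g} → StrictlyIncreasing f → StrictlyIncreasing g →
             (∀ n → ∃ λ m → g m ≡ f n) → (∀ n → ∃ λ m → f m ≡ g n) → ∀ n → f n ≡ g n
  range≡⇒≡ incf incg f⊆g g⊆f n = ℕₚ.≤-antisym (range⊆⇒≤ incg incf g⊆f n) (range⊆⇒≤ incf incg f⊆g n)

  square-cancel-< : ∀ {m n} → m * m < n * n → m < n
  square-cancel-< m²<n² = ℕₚ.≰⇒> (λ n≤m → ℕₚ.<⇒≱ m²<n² (ℕₚ.*-mono-≤ n≤m n≤m))

  square-injective : ∀ {m n} → m * m ≡ n * n → m ≡ n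
  square-injective {m} {n} eq = ℕₚ.≤-antisym
    (ℕₚ.≮⇒≥ (λ n<m → ℕₚ.<-irrefl (sym eq) (ℕₚ.*-mono-< n<m n<m)))
    (ℕₚ.≮⇒≥ (λ m<n → ℕₚ.<-irrefl eq (ℕₚ.*-mono-< m<n m<n)))

  -- The positive integers whose square is 121 modulo 240, in increasing order.
  root : ℕ → ℕ
  root 0 = 11
  root 1 = 19
  root 2 = 29
  root 3 = 59
  root 4 = 61
  root 5 = 91
  root 6 = 101
  root 7 = 109
  root (suc (suc (suc (suc (suc (suc (suc (suc n)))))))) = 120 + root n

  root-period : ∀ r p → root (r * 8 + p) ≡ r * 120 + root p
  root-period zero    p = refl
  root-period (suc r) p = trans (cong (_+_ 120) (root-period r p)) (sym (ℕₚ.+-assoc 120 (r * 120) (root p)))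

  root-increasing : StrictlyIncreasing root
  root-increasing 0 = from-yes (11 ℕ.<? 19)
  root-increasing 1 = from-yes (19 ℕ.<? 29)
  root-increasing 2 = from-yes (29 ℕ.<? 59)
  root-increasing 3 = from-yes (59 ℕ.<? 61)
  root-increasing 4 = from-yes (61 ℕ.<? 91)
  root-increasing 5 = from-yes (91 ℕ.<? 101)
  root-increasing 6 = from-yes (101 ℕ.<? 109)
  root-increasing 7 = from-yes (109 ℕ.<? 131)
  root-increasing (suc (suc (suc (suc (suc (suc (suc (suc n)))))))) = ℕₚ.+-monoʳ-< 120 (root-increasing n)

  -- Since 2·120 and 120² are multiples of 240, k² modulo 240 depends on k modulo 120 only; the 120
  -- residues are checked by evaluation.
  root-complete : ∀ k m → k * k ≡ 240 * m + 121 → ∃ λ n → root n ≡ k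
  root-complete k m eq = (k / 120) * 8 + p , (begin
    root ((k / 120) * 8 + p)  ≡⟨ root-period (k / 120) p ⟩
    (k / 120) * 120 + root p  ≡⟨ cong (_+_ ((k / 120) * 120)) root-p ⟩
    (k / 120) * 120 + k % 120 ≡⟨ ℕₚ.+-comm ((k / 120) * 120) (k % 120) ⟩
    k % 120 + (k / 120) * 120 ≡⟨ ℕDivMod.m≡m%n+[m/n]*n k 120 ⟨
    k                         ∎)
    where
    open ≡.≡-Reasoning
    expand : ∀ r t → (r + t * 120) * (r + t * 120) ≡ r * r + (t * r + 60 * (t * t)) * 240
    expand = ℕSolver.solve-∀
    rearrange : ∀ m → 240 * m + 121 ≡ 121 + m * 240
    rearrange = ℕSolver.solve-∀
    residue : (k % 120) * (k % 120) % 240 ≡ 121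
    residue = begin
      s * s % 240                                       ≡⟨ ℕDivMod.[m+kn]%n≡m%n (s * s) (t * s + 60 * (t * t)) 240 ⟨
      (s * s + (t * s + 60 * (t * t)) * 240) % 240      ≡⟨ cong (_% 240) (expand s t) ⟨
      (s + t * 120) * (s + t * 120) % 240               ≡⟨ cong (λ k → k * k % 240) (ℕDivMod.m≡m%n+[m/n]*n k 120) ⟨
      k * k % 240                                       ≡⟨ cong (_% 240) (trans eq (rearrange m)) ⟩
      (121 + m * 240) % 240                             ≡⟨ ℕDivMod.[m+kn]%n≡m%n 121 m 240 ⟩
      121                                               ∎
      where
      s = k % 120
      t = k / 120
    residues : ∀ {s} → s < 120 → s * s % 240 ≡ 121 → ∃ λ p → p < 8 × root p ≡ s
    residues = from-yes (ℕₚ.allUpTo? (λ s → (s * s % 240 ℕ.≟ 121) →-dec ℕₚ.anyUpTo? (λ p → root p ℕ.≟ s) 8) 120)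
    found = residues (ℕDivMod.m%n<n k 120) residue
    p = proj₁ found
    root-p = proj₂ (proj₂ found)

  -- Raising the index by 8 raises the floor by 2.
  sgn-period : ∀ r p → sgn (r * 8 + p) ≡ sgn p
  sgn-period zero    p = refl
  sgn-period (suc r) p = trans (shift (r * 8 + p)) (sgn-period r p)
    where
    shift : ∀ n → sgn (8 + n) ≡ sgn n
    shift n = begin
      -1ℤ ℤ.^ ((8 + (n + 2)) / 4)      ≡⟨ cong (-1ℤ ℤ.^_) (ℕDivMod.+-distrib-/-∣ˡ {8} (n + 2) {4} (divides 2 refl)) ⟩
      -1ℤ ℤ.^ (2 + (n + 2) / 4)        ≡⟨ ℤₚ.^-distribˡ-+-* -1ℤ 2 ((n + 2) / 4) ⟩
      1ℤ ℤ.* -1ℤ ℤ.^ ((n + 2) / 4)     ≡⟨ ℤₚ.*-identityˡ _ ⟩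
      -1ℤ ℤ.^ ((n + 2) / 4)            ∎
      where open ≡.≡-Reasoning

  -- The progressions 120 i + 11, 120 i + 19, 120 i + 59, 120 i + 91 with i ∈ ℤ
  -- contain each root exactly once up to sign.
  Class : Set
  Class = (ℤ ⊎ ℤ) ⊎ (ℤ ⊎ ℤ)

  -- `p` is the place of the root κ and `m` that of 120 - κ: for i = -(1 + r) the number 120i + κ is
  -- negative, with absolute value 120r + (120 - κ).
  index : ℕ → ℕ → ℤ → ℕ
  index p m (+ r)    = r * 8 + p
  index p m -[1+ r ] = r * 8 + m

  position : Class → ℕ
  position = [ [ index 0 7 , index 1 6 ] , [ index 3 4 , index 5 2 ] ]

  -- Eight places further in the list of roots is one step away from zero in the progression, in
  -- either direction.
  away : ℤ → ℤ
  away (+ r)    = + suc r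
  away -[1+ r ] = -[1+ suc r ]

  bump : Class → Class
  bump = Sum.map (Sum.map away away) (Sum.map away away)

  class : ℕ → Class
  class 0 = inj₁ (inj₁ 0ℤ)
  class 1 = inj₁ (inj₂ 0ℤ)
  class 2 = inj₂ (inj₂ -1ℤ)
  class 3 = inj₂ (inj₁ 0ℤ)
  class 4 = inj₂ (inj₁ -1ℤ)
  class 5 = inj₂ (inj₂ 0ℤ)
  class 6 = inj₁ (inj₂ -1ℤ)
  class 7 = inj₁ (inj₁ -1ℤ)
  class (suc (suc (suc (suc (suc (suc (suc (suc n)))))))) = bump (class n)

  class-index : ∀ (c : ℤ → Class) p m → class p ≡ c 0ℤ → class m ≡ c -1ℤ → (∀ i → bump (c i) ≡ c (away i)) →
                ∀ i → class (index p m i) ≡ c i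
  class-index c p m c₀ c₋₁ step (+ zero)     = c₀
  class-index c p m c₀ c₋₁ step (+ suc r)    =
    trans (cong bump (class-index c p m c₀ c₋₁ step (+ r))) (step (+ r))
  class-index c p m c₀ c₋₁ step -[1+ zero ]  = c₋₁
  class-index c p m c₀ c₋₁ step -[1+ suc r ] =
    trans (cong bump (class-index c p m c₀ c₋₁ step -[1+ r ])) (step -[1+ r ])

  class-position : ∀ x → class (position x) ≡ x
  class-position (inj₁ (inj₁ i)) = class-index (inj₁ ∘ inj₁) 0 7 refl refl (λ _ → refl) i
  class-position (inj₁ (inj₂ i)) = class-index (inj₁ ∘ inj₂) 1 6 refl refl (λ _ → refl) i
  class-position (inj₂ (inj₁ i)) = class-index (inj₂ ∘ inj₁) 3 4 refl refl (λ _ → refl) i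
  class-position (inj₂ (inj₂ i)) = class-index (inj₂ ∘ inj₂) 5 2 refl refl (λ _ → refl) i

  position-bump : ∀ x → position (bump x) ≡ 8 + position x
  position-bump (inj₁ (inj₁ (+ _)))    = refl
  position-bump (inj₁ (inj₁ -[1+ _ ])) = refl
  position-bump (inj₁ (inj₂ (+ _)))    = refl
  position-bump (inj₁ (inj₂ -[1+ _ ])) = refl
  position-bump (inj₂ (inj₁ (+ _)))    = refl
  position-bump (inj₂ (inj₁ -[1+ _ ])) = refl
  position-bump (inj₂ (inj₂ (+ _)))    = refl
  position-bump (inj₂ (inj₂ -[1+ _ ])) = refl

  position-class : ∀ n → position (class n) ≡ n
  position-class 0 = refl
  position-class 1 = refl
  position-class 2 = refl
  position-class 3 = refl
  position-class 4 = refl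
  position-class 5 = refl
  position-class 6 = refl
  position-class 7 = refl
  position-class (suc (suc (suc (suc (suc (suc (suc (suc n)))))))) =
    trans (position-bump (class n)) (cong (_+_ 8) (position-class n))

  position-injective : ∀ {x y} → position x ≡ position y → x ≡ y
  position-injective {x} {y} eq = trans (sym (class-position x)) (trans (cong class eq) (class-position y))

  position-surjective : ∀ n → ∃ λ x → position x ≡ n
  position-surjective n = class n , position-class n

  root²-index : ∀ p m → root p + root m ≡ 120 → ∀ i →
    + root (index p m i) ℤ.* + root (index p m i) ≡ (+ 120 ℤ.* i ℤ.+ + root p) ℤ.* (+ 120 ℤ.* i ℤ.+ + root p)
  root²-index p m _ (+ r) = cong (λ x → x ℤ.* x) (begin
    + root (r * 8 + p)             ≡⟨ cong +_ (root-period r p) ⟩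
    + (r * 120) ℤ.+ + root p       ≡⟨ cong (ℤ._+ + root p) (ℤₚ.pos-* r 120) ⟩
    + r ℤ.* + 120 ℤ.+ + root p     ≡⟨ cong (ℤ._+ + root p) (ℤₚ.*-comm (+ r) (+ 120)) ⟩
    + 120 ℤ.* + r ℤ.+ + root p     ∎)
    where open ≡.≡-Reasoning
  root²-index p m complementary -[1+ r ] = begin
    + root (r * 8 + m) ℤ.* + root (r * 8 + m)
      ≡⟨ cong (λ k → + k ℤ.* + k) (root-period r m) ⟩
    (+ (r * 120) ℤ.+ + root m) ℤ.* (+ (r * 120) ℤ.+ + root m)
      ≡⟨ cong₂ (λ x y → (x ℤ.+ y) ℤ.* (x ℤ.+ y)) (ℤₚ.pos-* r 120) root-m ⟩
    (+ r ℤ.* + 120 ℤ.+ (+ 120 ℤ.- + root p)) ℤ.* (+ r ℤ.* + 120 ℤ.+ (+ 120 ℤ.- + root p))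
      ≡⟨ negate (+ r) (+ root p) ⟩
    (+ 120 ℤ.* -[1+ r ] ℤ.+ + root p) ℤ.* (+ 120 ℤ.* -[1+ r ] ℤ.+ + root p) ∎
    where
    open ≡.≡-Reasoning
    root-m : + root m ≡ + 120 ℤ.- + root p
    root-m = trans (cancel (+ root p) (+ root m)) (cong (λ s → + s ℤ.- + root p) complementary)
      where
      cancel : ∀ x y → y ≡ x ℤ.+ y ℤ.- x
      cancel = solve-∀
    negate : ∀ r κ → (r ℤ.* + 120 ℤ.+ (+ 120 ℤ.- κ)) ℤ.* (r ℤ.* + 120 ℤ.+ (+ 120 ℤ.- κ))
           ≡ (+ 120 ℤ.* (ℤ.- (1ℤ ℤ.+ r)) ℤ.+ κ) ℤ.* (+ 120 ℤ.* (ℤ.- (1ℤ ℤ.+ r)) ℤ.+ κ)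
    negate = solve-∀

  root-index : ∀ p m C → root p + root m ≡ 120 → + root p ℤ.* + root p ≡ + 240 ℤ.* C ℤ.+ + 121 →
    ∀ i → + root (index p m i) ℤ.* + root (index p m i) ≡ + 240 ℤ.* quad (+ 60) (+ root p) C i ℤ.+ + 121
  root-index p m C complementary base i = begin
    + root (index p m i) ℤ.* + root (index p m i)                   ≡⟨ root²-index p m complementary i ⟩
    (+ 120 ℤ.* i ℤ.+ κ) ℤ.* (+ 120 ℤ.* i ℤ.+ κ)                     ≡⟨ expand i κ ⟩
    x ℤ.+ κ ℤ.* κ                                                   ≡⟨ cong (ℤ._+_ x) base ⟩
    x ℤ.+ (+ 240 ℤ.* C ℤ.+ + 121)                                   ≡⟨ collect i κ C (+ 121) ⟩
    + 240 ℤ.* quad (+ 60) κ C i ℤ.+ + 121                           ∎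
    where
    open ≡.≡-Reasoning
    κ = + root p
    x = + 240 ℤ.* (+ 60 ℤ.* (i ℤ.* i) ℤ.+ κ ℤ.* i)
    expand : ∀ i κ → (+ 120 ℤ.* i ℤ.+ κ) ℤ.* (+ 120 ℤ.* i ℤ.+ κ) ≡ + 240 ℤ.* (+ 60 ℤ.* (i ℤ.* i) ℤ.+ κ ℤ.* i) ℤ.+ κ ℤ.* κ
    expand = solve-∀
    collect : ∀ i κ C c → + 240 ℤ.* (+ 60 ℤ.* (i ℤ.* i) ℤ.+ κ ℤ.* i) ℤ.+ (+ 240 ℤ.* C ℤ.+ c)
            ≡ + 240 ℤ.* (+ 60 ℤ.* (i ℤ.* i) ℤ.+ κ ℤ.* i ℤ.+ C) ℤ.+ c
    collect = solve-∀

  exponentOf : Class → ℤ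
  exponentOf = [ [ quad (+ 60) (+ 11) 0ℤ , quad (+ 60) (+ 19) 1ℤ ] , [ quad (+ 60) (+ 59) (+ 14) , quad (+ 60) (+ 91) (+ 34) ] ]

  root-position : ∀ x → + root (position x) ℤ.* + root (position x) ≡ + 240 ℤ.* exponentOf x ℤ.+ + 121
  root-position (inj₁ (inj₁ i)) = root-index 0 7 0ℤ refl refl i
  root-position (inj₁ (inj₂ i)) = root-index 1 6 1ℤ refl refl i
  root-position (inj₂ (inj₁ i)) = root-index 3 4 (+ 14) refl refl i
  root-position (inj₂ (inj₂ i)) = root-index 5 2 (+ 34) refl refl i

  0≤exponentOf : ∀ x → 0ℤ ℤ.≤ exponentOf x
  0≤exponentOf (inj₁ (inj₁ i)) = 0≤quad (from-yes (admissible? (+ 60) (+ 11) 0ℤ)) i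
  0≤exponentOf (inj₁ (inj₂ i)) = 0≤quad (from-yes (admissible? (+ 60) (+ 19) 1ℤ)) i
  0≤exponentOf (inj₂ (inj₁ i)) = 0≤quad (from-yes (admissible? (+ 60) (+ 59) (+ 14))) i
  0≤exponentOf (inj₂ (inj₂ i)) = 0≤quad (from-yes (admissible? (+ 60) (+ 91) (+ 34))) i

  signOf : Class → ℤ
  signOf = [ (λ _ → 1ℤ) , (λ _ → -1ℤ) ]

  sgn-index : ∀ p m {s} → sgn p ≡ s → sgn m ≡ s → ∀ i → sgn (index p m i) ≡ s
  sgn-index p m sp sm (+ r)    = trans (sgn-period r p) sp
  sgn-index p m sp sm -[1+ r ] = trans (sgn-period r m) sm

  -- The floor of (n + 2)/4 is even for n ≡ 0, 1, 6, 7 and odd for n ≡ 2, 3, 4, 5 modulo 8; the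
  -- first four are the places of the progressions of 11 and 19.
  sgn-position : ∀ x → sgn (position x) ≡ signOf x
  sgn-position (inj₁ (inj₁ i)) = sgn-index 0 7 refl refl i
  sgn-position (inj₁ (inj₂ i)) = sgn-index 1 6 refl refl i
  sgn-position (inj₂ (inj₁ i)) = sgn-index 3 4 refl refl i
  sgn-position (inj₂ (inj₂ i)) = sgn-index 5 2 refl refl i

  module Enumeration (a : ℕ → ℕ) (increasing : StrictlyIncreasing a)
    (square : ∀ n → IsSquare (240 * a n + 121))
    (complete : ∀ m → IsSquare (240 * m + 121) → ∃ λ n → a n ≡ m) where

    private
      α : ℕ → ℕ
      α n = proj₁ (square n)

      α² : ∀ n → α n * α n ≡ 240 * a n + 121
      α² n = proj₂ (square n)

      α-increasing : StrictlyIncreasing α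
      α-increasing n = square-cancel-< (subst₂ _<_ (sym (α² n)) (sym (α² (suc n)))
        (ℕₚ.+-monoˡ-< 121 (ℕₚ.*-monoʳ-< 240 (increasing n))))

      root⊆α : ∀ n → ∃ λ m → α m ≡ root n
      root⊆α n = proj₁ found , square-injective (trans (α² (proj₁ found))
        (trans (cong (λ e → 240 * e + 121) (proj₂ found)) (sym root²)))
        where
        e = ∣ exponentOf (class n) ∣
        root² : root n * root n ≡ 240 * e + 121
        root² = ℤₚ.+-injective (begin
          + (root n * root n)                                     ≡⟨ ℤₚ.pos-* (root n) (root n) ⟩
          + root n ℤ.* + root n                                   ≡⟨ cong (λ k → + root k ℤ.* + root k) (position-class n) ⟨
          + root (position (class n)) ℤ.* + root (position (class n)) ≡⟨ root-position (class n) ⟩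
          + 240 ℤ.* exponentOf (class n) ℤ.+ + 121
            ≡⟨ cong (λ x → + 240 ℤ.* x ℤ.+ + 121) (ℤₚ.0≤i⇒+∣i∣≡i (0≤exponentOf (class n))) ⟨
          + 240 ℤ.* + e ℤ.+ + 121                                 ≡⟨ cong (ℤ._+ + 121) (ℤₚ.pos-* 240 e) ⟨
          + (240 * e + 121)                                       ∎)
          where open ≡.≡-Reasoning
        found = complete e (root n , root²)

    -- Two strictly increasing sequences with the same range; that every `root` occurs comes from
    -- `complete`.
    α≡root : ∀ n → proj₁ (square n) ≡ root n
    α≡root = range≡⇒≡ α-increasing root-increasing (λ n → root-complete (α n) (a n) (α² n)) root⊆α

    a-position : ∀ x → + a (position x) ≡ exponentOf x
    a-position x = ℤₚ.*-cancelˡ-≡ (+ 240) _ _ (cancel (begin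
      + 240 ℤ.* + a n ℤ.+ + 121       ≡⟨ cong (ℤ._+ + 121) (ℤₚ.pos-* 240 (a n)) ⟨
      + (240 * a n + 121)             ≡⟨ cong +_ (α² n) ⟨
      + (α n * α n)                   ≡⟨ ℤₚ.pos-* (α n) (α n) ⟩
      + α n ℤ.* + α n                 ≡⟨ cong (λ k → + k ℤ.* + k) (α≡root n) ⟩
      + root n ℤ.* + root n           ≡⟨ root-position x ⟩
      + 240 ℤ.* exponentOf x ℤ.+ + 121 ∎))
      where
      open ≡.≡-Reasoning
      n = position x
      cancel : ∀ {i j} → i ℤ.+ + 121 ≡ j ℤ.+ + 121 → i ≡ j
      cancel {i} {j} e = trans (sym (x+y-y i)) (trans (cong (ℤ._- + 121) e) (x+y-y j))
        where
        x+y-y : ∀ x → x ℤ.+ + 121 ℤ.- + 121 ≡ x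
        x+y-y = solve-∀

open Roots

-- The coefficient of q^N on both sides of the theorem.

double≡0⇒≡0 : ∀ i → i ℤ.+ i ≡ 0ℤ → i ≡ 0ℤ
double≡0⇒≡0 i eq = ℤₚ.*-cancelˡ-≡ (+ 2) i 0ℤ (≡.trans (double i) eq)
  where
  double : ∀ i → + 2 ℤ.* i ≡ i ℤ.+ i
  double = solve-∀

≡ᵇ-comm : ∀ m n → (m ≡ᵇ n) ≡ (n ≡ᵇ m)
≡ᵇ-comm zero    zero    = ≡.refl
≡ᵇ-comm zero    (suc n) = ≡.refl
≡ᵇ-comm (suc m) zero    = ≡.refl
≡ᵇ-comm (suc m) (suc n) = ≡ᵇ-comm m n

truncatedPowers : ℕ → TruncatedPowers
truncatedPowers N = record
  { commutativeRing = ring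
  ; N           = N
  ; q           = qpow
  ; q-0         = everywhere (λ _ → ≡.refl)
  ; q-+         = λ m n → everywhere (qpow-+ m n)
  ; q-vanish    = λ N<n → agree (λ i≤N → qpow-vanish (ℕₚ.≤-<-trans i≤N N<n))
  ; geo         = λ n → recip (oneMinusQ n)
  ; geo-inverse = λ { {suc n} _ → everywhere (λ i →
      ≡.trans (⊛-comm (recip (oneMinusQ (suc n))) (oneMinusQ (suc n)) i) (⊛-recip (oneMinusQ (suc n)) ≡.refl i)) }
  ; x+x≈0⇒x≈0   = λ x+x≈0 → agree (λ i≤N → double≡0⇒≡0 _ (at x+x≈0 i≤N)) }
  where open Truncation N

-- An equality of functions and not only modulo q^(N+1), as `oneMinusQ e` computes to 1 minus
-- `qpow e`. It holds for every N, which allows a change of truncation.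
finPoch≡prod : ∀ N r k j → finPoch r k j ≡ Theta.prod (truncatedPowers N) Sign.- r k j
finPoch≡prod N r k zero    = ≡.refl
finPoch≡prod N r k (suc j) = ≡.cong (_⊛ oneMinusQ (r ℕ.+ k ℕ.* j)) (finPoch≡prod N r k j)

-- `poch` takes i + 1 factors for the coefficient of q^i, `prod∞` takes N + 1. Stability is applied
-- in the truncation at i, where i + 1 factors are already enough.
poch≡prod∞ : ∀ N r {k} → 1 ℕ.≤ k → ∀ {i} → i ℕ.≤ N →
             poch r k i ≡ Theta.prod∞ (truncatedPowers N) Sign.- r k i
poch≡prod∞ N r {k} 1≤k {i} i≤N = begin
  finPoch r k (suc i) i          ≡⟨ ≡.cong-app (finPoch≡prod i r k (suc i)) i ⟩
  Tᵢ.prod Sign.- r k (suc i) i   ≡⟨ Truncation.at (Tᵢ.prod-stable Sign.- r 1≤k (s≤s i≤N)) ℕₚ.≤-refl ⟨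
  Tᵢ.prod Sign.- r k (suc N) i   ≡⟨ ≡.cong-app (finPoch≡prod i r k (suc N)) i ⟨
  finPoch r k (suc N) i          ≡⟨ ≡.cong-app (finPoch≡prod N r k (suc N)) i ⟩
  Theta.prod (truncatedPowers N) Sign.- r k (suc N) i ∎
  where
  open ≡.≡-Reasoning
  module Tᵢ = Theta (truncatedPowers i)

module Coefficient (a : ℕ → ℕ) (increasing : StrictlyIncreasing a)
  (square : ∀ n → IsSquare (240 ℕ.* a n ℕ.+ 121))
  (complete : ∀ m → IsSquare (240 ℕ.* m ℕ.+ 121) → ∃ λ n → a n ≡ m) (N : ℕ) where

  open Enumeration a increasing square complete
  open Truncation N using (ring; agree; at; everywhere)
  open CommutativeRing ring
    using (_≈_; setoid; refl; sym; trans; reflexive; +-assoc; *-cong; *-congˡ; *-congʳ; *-assoc; *-identityʳ)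
  open Summation ring
  open Theta (truncatedPowers N)
  open KeyIdentity (truncatedPowers N)
  open import Relation.Binary.Reasoning.Setoid setoid

  summand : ℕ → FPS
  summand n = scale (sgn n) (qpow (a n))

  partialSum : FPS
  partialSum = ∑ (upTo (suc N)) summand

  ∑-applyUpTo : ∀ n (g : ℕ → ℕ) (f : ℕ → FPS) k → ∑ (applyUpTo g (suc n)) f k ≡ sumTo n (λ i → f (g i) k)
  ∑-applyUpTo zero    g f k = ℤₚ.+-identityʳ _
  ∑-applyUpTo (suc n) g f k = ≡.trans (≡.cong (ℤ._+_ (f (g 0) k)) (∑-applyUpTo n (g ∘ suc) f k))
    (≡.sym (sumTo-suc n (λ i → f (g i) k)))

  scale-qpow : ∀ s e n → s ℤ.* qpow e n ≡ (if e ≡ᵇ n then s else 0ℤ)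
  scale-qpow s e n rewrite ≡ᵇ-comm n e with e ≡ᵇ n
  ... | true  = ℤₚ.*-identityʳ s
  ... | false = ℤₚ.*-zeroʳ s

  -- Stated at N only, because the number of summands in `lhsSeries` changes with the coefficient.
  partialSum-N : partialSum N ≡ lhsSeries a N
  partialSum-N = ≡.trans (∑-applyUpTo N (λ n → n) summand N)
    (sumTo-cong N (λ n _ → scale-qpow (sgn n) (a n) N))

  partialSum-hasSum : HasSum summand partialSum
  partialSum-hasSum = record
    { support = upTo (suc N)
    ; unique  = Unique.upTo⁺ (suc N)
    -- n ≤ a n for a strictly increasing sequence, so the indices beyond N contribute nothing.
    ; vanish  = λ {n} n∉ → agree (λ {i} i≤N → ≡.trans
        (≡.cong (sgn n ℤ.*_) (qpow-vanish (ℕₚ.≤-<-trans i≤N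
          (ℕₚ.≤-trans (ℕₚ.≮⇒≥ (λ n<1+N → n∉ (∈-upTo⁺ n<1+N))) (strictlyIncreasing⇒n≤f[n] increasing n)))))
        (ℤₚ.*-zeroʳ (sgn n)))
    ; total   = refl }

  summand-position : ∀ x → summand (position x) ≈ scale (signOf x) (mono (exponentOf x))
  summand-position x = everywhere (λ i → ≡.cong₂ (λ s e → s ℤ.* mono e i) (sgn-position x) (a-position x))

  scale-1 : ∀ f → scale 1ℤ f ≈ f
  scale-1 f = everywhere (λ i → ℤₚ.*-identityˡ (f i))

  scale--1 : ∀ f → scale -1ℤ f ≈ ⊟ f
  scale--1 f = everywhere (λ i → ℤₚ.-1*i≡-i (f i))

  classes-hasSum : HasSum summand ((theta60 (+ 11) 0ℤ ⊞ theta60 (+ 19) 1ℤ)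
                                    ⊞ (⊟ theta60 (+ 59) (+ 14) ⊞ ⊟ theta60 (+ 91) (+ 34)))
  classes-hasSum = hasSum-bij position position-injective position-surjective (hasSum-⊎
    (hasSum-⊎ (positive (inj₁ ∘ inj₁) (λ _ → ≡.refl) (hasSum (thetaOf plus (+ 60) (+ 11) 0ℤ)))
              (positive (inj₁ ∘ inj₂) (λ _ → ≡.refl) (hasSum (thetaOf plus (+ 60) (+ 19) 1ℤ))))
    (hasSum-⊎ (negative (inj₂ ∘ inj₁) (λ _ → ≡.refl) (hasSum (thetaOf plus (+ 60) (+ 59) (+ 14))))
              (negative (inj₂ ∘ inj₂) (λ _ → ≡.refl) (hasSum (thetaOf plus (+ 60) (+ 91) (+ 34))))))
    where
    open ThetaSum
    positive : ∀ (c : ℤ → Class) {s} → (∀ i → signOf (c i) ≡ 1ℤ) → HasSum (λ i → mono (exponentOf (c i))) s →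
               HasSum (λ i → summand (position (c i))) s
    positive c signs = hasSum-cong (λ i → sym (trans (summand-position (c i))
      (trans (reflexive (≡.cong (λ u → scale u (mono (exponentOf (c i)))) (signs i))) (scale-1 (mono (exponentOf (c i))))))) refl
    negative : ∀ (c : ℤ → Class) {s} → (∀ i → signOf (c i) ≡ -1ℤ) → HasSum (λ i → mono (exponentOf (c i))) s →
               HasSum (λ i → summand (position (c i))) (⊟ s)
    negative c signs H = hasSum-cong (λ i → sym (trans (summand-position (c i))
      (trans (reflexive (≡.cong (λ u → scale u (mono (exponentOf (c i)))) (signs i))) (scale--1 (mono (exponentOf (c i))))))) refl (hasSum-neg H)

  partialSum≈D : partialSum ≈ D
  partialSum≈D = trans (hasSum-unique ℕₚ._≟_ partialSum-hasSum classes-hasSum) (sym (+-assoc (theta60 (+ 11) 0ℤ ⊞ theta60 (+ 19) 1ℤ) (⊟ theta60 (+ 59) (+ 14)) (⊟ theta60 (+ 91) (+ 34))))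

  poch≈ : ∀ r {k} → 1 ℕ.≤ k → poch r k ≈ prod∞ Sign.- r k
  poch≈ r 1≤k = agree (poch≡prod∞ N r 1≤k)

  partialSum≈rhs : partialSum ≈ rhsSeries
  partialSum≈rhs = trans partialSum≈D (divide D denominator (recip denominator)
    -- The constant term of the denominator is 1 by evaluation.
    (everywhere (⊛-recip denominator ≡.refl))
    (trans (*-congˡ {x = D} (*-cong (poch≈ 1 (s≤s z≤n)) (poch≈ 4 (s≤s z≤n))))
      (trans D-product (sym (*-cong (*-cong (*-cong (poch≈ 3 (s≤s z≤n)) (poch≈ 5 (s≤s z≤n))) (poch≈ 8 (s≤s z≤n)))
                                    (*-cong (poch≈ 2 (s≤s z≤n)) (poch≈ 14 (s≤s z≤n))))))))
    where
    denominator : FPS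
    denominator = poch 1 5 ⊛ poch 4 5
    divide : ∀ x d r {c} → (d ⊛ r) ≈ oneS → (x ⊛ d) ≈ c → x ≈ (c ⊛ r)
    divide x d r {c} dr≈1 xd≈c = begin
      x             ≈⟨ *-identityʳ x ⟨
      x ⊛ oneS      ≈⟨ *-congˡ {x = x} dr≈1 ⟨
      x ⊛ (d ⊛ r)   ≈⟨ *-assoc x d r ⟨
      (x ⊛ d) ⊛ r   ≈⟨ *-congʳ {x = r} xd≈c ⟩
      c ⊛ r         ∎


open import Data.Nat using (_+_; _*_)

theorem9 : (a : ℕ → ℕ)
    → StrictlyIncreasing a
    → (∀ n → IsSquare (240 * a n + 121))
    → (∀ m → IsSquare (240 * m + 121) → ∃ λ n → a n ≡ m)
    → ∀ N → lhsSeries a N ≡ rhsSeries N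
theorem9 a increasing square complete N =
  ≡.trans (≡.sym partialSum-N) (Truncation.at partialSum≈rhs ℕₚ.≤-refl)
  where open Coefficient a increasing square complete N
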